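{- Let $P$ be a tree poset of height $h$ and let $x\in P$ be such that every element of $P$ is at distance at most $2$ from $x$ in the undirected Hasse diagram of $P$. Then for every $\varepsilon>0$ there exists $\delta>0$ such that for every sufficiently large $n\in\mathbb N$ the following holds: every family $\mathcal F\subseteq 2^{[n]}$ with $|\mathcal F|\ge (h-1+\varepsilon)\binom{n}{\lfloor n/2\rfloor}$ contains a copy of the blow-up $P(x,\delta n)$.
   Context: Posets are finite collections of finite sets ordered by inclusion. A poset homomorphism $\phi:P\to Q$ is a map with $A\subseteq B\Rightarrow \phi(A)\subseteq\phi(B)$; $Q$ contains a copy of $P$ if there is an injective poset homomorphism $P\to Q$. The Hasse diagram of $P$ is the directed graph on $P$ with an edge $A\to B$ when $A\subsetneq B$ and no $C\in P$ has $A\subsetneq C\subsetneq B$; the undirected Hasse diagram forgets orientations. A tree poset is a poset whose undirected Hasse diagram is a tree. The height of $P$ is the number of elements of a longest chain in $P$. For a tree poset $P$, $x\in P$ and an integer $d\ge2$, the $d$-blow-up $P(x,d)$ rooted at $x$ is the tree poset whose Hasse diagram is obtained as follows: each $u\in P$ at distance $\rho$ from $x$ in the undirected Hasse diagram is replaced by $d^{\rho}$ elements $u^1,\dots,u^{d^\rho}$; for each edge $uv$ of the Hasse diagram with $v$ at distance $\rho-1$ from $x$ (and $u$ at distance $\rho$), the $u^i$ are partitioned into $d^{\rho-1}$ disjoint sets $U^1,\dots,U^{d^{\rho-1}}$ of size $d$ and $v^j$ is joined to every element of $U^j$, with the same orientation as the edge $uv$. The parameter $\delta n$ is rounded down to an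 integer. -}

module Defs where

open import Level using (0ℓ)
open import Data.Nat using (ℕ; zero; suc; _+_; _*_; _^_; _≤_; z≤n; s≤s)
open import Data.Fin using (Fin; toℕ)
open import Data.Fin.Properties using (any?; _≟_)
open import Data.Fin.Subset using (Subset)
open import Data.Fin.Subset.Properties using (⊆-poset)
import Data.Integer as ℤ
open import Data.Rational using (ℚ; floor) renaming (_/_ to _÷_; _*_ to _*ℚ_)
open import Data.List using (List; []; _∷_; _∷ʳ_; length)
open import Data.List.Membership.Propositional using (_∈_)
open import Data.List.Relation.Unary.AllPairs using (AllPairs)
open import Data.List.Relation.Unary.Linked using (Linked)
open import Data.List.Relation.Unary.Unique.Propositional using (Unique)
open import Data.Product using (Σ; Σ-syntax; ∃; ∃-syntax; _×_; _,_; proj₁; proj₂)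
open import Data.Sum using (_⊎_; inj₁; inj₂)
open import Function.Bundles using (_⇔_; mk⇔)
open import Function.Definitions using (Injective)
open import Relation.Binary using (Rel; Poset; IsDecPartialOrder; Decidable)
open import Relation.Binary.Construct.Closure.ReflexiveTransitive using (Star; ε; _◅_; _◅◅_)
open import Relation.Binary.Construct.Closure.Symmetric using (SymClosure; fwd; bwd)
import Relation.Binary.Construct.On as On
open import Relation.Binary.Morphism.Bundles using (PosetHomomorphism)
import Relation.Binary.Properties.Poset as PosetProperties
open import Relation.Binary.PropositionalEquality using (_≡_; refl; isEquivalence)
open import Relation.Nullary using (¬_; Dec; yes; no; contradiction)
open import Relation.Nullary.Decidable using (map′; _×-dec_; _⊎-dec_; ¬?)
open import Relation.Unary using (Pred)
import Relation.Unary as U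

IsLeast : Pred ℕ 0ℓ → ℕ → Set
IsLeast P m = P m × (∀ k → P k → m ≤ k)

least : {P : Pred ℕ 0ℓ} → U.Decidable P → ∃ P → ∃ (IsLeast P)
least {P} P? (n , p) = search P? n p
  where
  search : {Q : Pred ℕ 0ℓ} → U.Decidable Q → ∀ n → Q n → ∃ (IsLeast Q)
  search Q? zero    q = zero , q , λ _ _ → z≤n
  search Q? (suc n) q with Q? zero
  ... | yes q₀ = zero , q₀ , λ _ _ → z≤n
  ... | no ¬q₀ with search (λ k → Q? (suc k)) n q
  ...   | m , qₘ , min = suc m , qₘ , λ
          { zero    q₀ → contradiction q₀ ¬q₀
          ; (suc k) qₖ → s≤s (min k qₖ) }

module Graph {V : Set} (_~_ : Rel V 0ℓ) where

  data Walk : ℕ → Rel V 0ℓ where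
    []  : ∀ {u} → Walk 0 u u
    _∷_ : ∀ {n u v w} → u ~ v → Walk n v w → Walk (suc n) u w

  Connected : Set
  Connected = ∀ u v → ∃[ n ] Walk n u v

  -- The vertices of a cycle are listed once each, so the closing edge
  -- runs from the last one back to v.
  IsCycle : V → List V → Set
  IsCycle v vs = 2 ≤ length vs × Unique (v ∷ vs) × Linked _~_ ((v ∷ vs) ∷ʳ v)

  Acyclic : Set
  Acyclic = ∀ v vs → ¬ IsCycle v vs

  IsTree : Set
  IsTree = Connected × Acyclic

  IsDistance : V → V → ℕ → Set
  IsDistance u v = IsLeast (λ n → Walk n u v)

module _ {k} {_~_ : Rel (Fin k) 0ℓ} (_~?_ : Decidable _~_) where
  open Graph _~_

  walk? : ∀ n → Decidable (Walk n)
  walk? zero    u w = map′ (λ { refl → [] }) (λ { [] → refl }) (u ≟ w)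
  walk? (suc n) u w =
    map′ (λ { (v , e , p) → e ∷ p }) (λ { (e ∷ p) → _ , e , p })
         (any? λ v → (u ~? v) ×-dec walk? n v w)

  distance : Connected → ∀ u v → ∃ (IsDistance u v)
  distance conn u v = least (λ n → walk? n u v) (conn u v)

module Covering {a ℓ₁ ℓ₂} (P : Poset a ℓ₁ ℓ₂) where
  open PosetProperties P using (_<_) public

  infix 4 _⋖_

  -- The edges of the Hasse diagram.
  _⋖_ : Rel (Poset.Carrier P) _
  u ⋖ v = u < v × ¬ (∃[ w ] u < w × w < v)

-- Q contains a copy of P; the copy need not be induced.
ContainsCopy : ∀ {a ℓ₁ ℓ₂ b ℓ₃ ℓ₄} → Poset b ℓ₃ ℓ₄ → Poset a ℓ₁ ℓ₂ → Set _
ContainsCopy Q P =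
  Σ[ φ ∈ PosetHomomorphism P Q ]
    Injective (Poset._≈_ P) (Poset._≈_ Q) (PosetHomomorphism.⟦_⟧ φ)

-- Finite posets up to isomorphism.  Inclusion makes any finite collection of
-- finite sets into one, and each one arises in this way from its collection
-- of principal down-sets.
record FinPoset : Set₁ where
  infix 4 _≼_
  field
    size              : ℕ
    _≼_               : Rel (Fin size) 0ℓ
    isDecPartialOrder : IsDecPartialOrder _≡_ _≼_

  Carrier : Set
  Carrier = Fin size

  open IsDecPartialOrder isDecPartialOrder public
    using (isPartialOrder) renaming (_≤?_ to _≼?_; refl to ≼-refl; trans to ≼-trans)

  poset : Poset 0ℓ 0ℓ 0ℓ
  poset = record { isPartialOrder = isPartialOrder }

  open Covering poset public renaming (_<_ to _≺_)

  _~_ : Rel Carrier 0ℓ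
  _~_ = SymClosure _⋖_

  _≺?_ : Decidable _≺_
  u ≺? v = (u ≼? v) ×-dec ¬? (u ≟ v)

  _⋖?_ : Decidable _⋖_
  u ⋖? v = (u ≺? v) ×-dec ¬? (any? λ w → (u ≺? w) ×-dec (w ≺? v))

  _~?_ : Decidable _~_
  u ~? v = map′ (λ { (inj₁ e) → fwd e ; (inj₂ e) → bwd e })
                (λ { (fwd e) → inj₁ e ; (bwd e) → inj₂ e })
                ((u ⋖? v) ⊎-dec (v ⋖? u))

  -- The elements of a chain are distinct and may be listed in any order.
  IsChain : List Carrier → Set
  IsChain = AllPairs (λ u v → u ≺ v ⊎ v ≺ u)

  IsHeight : ℕ → Set
  IsHeight h = (∃[ xs ] IsChain xs × length xs ≡ h)
             × (∀ xs → IsChain xs → length xs ≤ h)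

record TreePoset : Set₁ where
  field
    finPoset : FinPoset
  open FinPoset finPoset public
  field
    isTree : Graph.IsTree _~_

  dist : Carrier → Carrier → ℕ
  dist u v = proj₁ (distance _~?_ (proj₁ isTree) u v)

module _ (P : TreePoset) (x : TreePoset.Carrier P) (d : ℕ) where
  open TreePoset P

  -- (u , i) is the copy uⁱ.
  Copies : Set
  Copies = Σ[ u ∈ Carrier ] Fin (d ^ dist x u)

  -- Let u be at distance one more than v.  The copies of u are partitioned
  -- into the blocks Uʲ = { uⁱ ∣ jd ≤ i < jd + d }, and vʲ is joined to Uʲ.
  InBlock : Copies → Copies → Set
  InBlock (u , i) (v , j) =
    dist x u ≡ suc (dist x v) × (∃[ r ] toℕ i ≡ toℕ j * d + toℕ {d} r)

  infix 4 _⟶_ _⟶*_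

  _⟶_ : Rel Copies 0ℓ
  a ⟶ b = proj₁ a ⋖ proj₁ b × (InBlock a b ⊎ InBlock b a)

  _⟶*_ : Rel Copies 0ℓ
  _⟶*_ = Star _⟶_

  private
    below : ∀ {a b} → a ⟶* b → proj₁ a ≼ proj₁ b
    below ε             = ≼-refl
    below ((e , _) ◅ p) = ≼-trans (proj₁ (proj₁ e)) (below p)

    acyclic : ∀ {a b c} → a ⟶ b → b ⟶* c → ¬ (c ⟶* a)
    acyclic ((a⋖b) , _) p q =
      PosetProperties.<⇒≱ poset (proj₁ a⋖b) (≼-trans (below p) (below q))

    antisym : ∀ {a b} → a ⟶* b → b ⟶* a → a ≡ b
    antisym ε       _ = refl
    antisym (e ◅ p) q = contradiction q (acyclic e p)

  blowUp : Poset 0ℓ 0ℓ 0ℓ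
  blowUp = record
    { Carrier        = Copies
    ; _≈_            = _≡_
    ; _≤_            = _⟶*_
    ; isPartialOrder = record
      { isPreorder = record
        { isEquivalence = isEquivalence
        ; reflexive     = λ { refl → ε }
        ; trans         = _◅◅_
        }
      ; antisym = antisym
      }
    }

  private
    module B = Covering blowUp

    strictlyBelow : ∀ {a b} → a B.< b → proj₁ a ≺ proj₁ b
    strictlyBelow (ε , a≢b)           = contradiction refl a≢b
    strictlyBelow (e ◅ p , _)         =
      below (e ◅ p) ,
      λ { refl → PosetProperties.<⇒≱ poset (proj₁ (proj₁ e)) (below p) }

    ⟶⇒< : ∀ {a b} → a ⟶ b → a B.< b
    ⟶⇒< e = e ◅ ε , λ { refl → acyclic e ε ε }

  -- The Hasse diagram of the blow-up is the one prescribed.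
  blowUp-hasse : ∀ {a b} → a B.⋖ b ⇔ a ⟶ b
  blowUp-hasse = mk⇔ to from
    where
    to : ∀ {a b} → a B.⋖ b → a ⟶ b
    to ((ε , a≢b) , _)         = contradiction refl a≢b
    to ((e ◅ ε , _) , _)       = e
    to ((e ◅ f ◅ p , _) , gap) =
      contradiction (_ , ⟶⇒< e , f ◅ p , λ { refl → acyclic f p ε }) gap

    from : ∀ {a b} → a ⟶ b → a B.⋖ b
    from e = ⟶⇒< e , λ { (c , a<c , c<b) →
      proj₂ (proj₁ e) (proj₁ c , strictlyBelow a<c , strictlyBelow c<b) }

record Family (n : ℕ) : Set where
  field
    members : List (Subset n)
    unique  : Unique members

  card : ℕ
  card = length members

familyPoset : ∀ {n} → Family n → Poset 0ℓ 0ℓ 0ℓ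
familyPoset {n} F = On.poset (⊆-poset n) (proj₁ {B = _∈ Family.members F})

-- Parameters such as ε and δ are rational.  No generality is lost: a real
-- ε > 0 may be replaced by a smaller positive rational.
fromℕ : ℕ → ℚ
fromℕ n = ℤ.+ n ÷ 1

-- ⌊ δ n ⌋; the absolute value only changes the type when δ ≥ 0.
⌊_·_⌋ : ℚ → ℕ → ℕ
⌊ δ · n ⌋ = ℤ.∣ floor (δ *ℚ fromℕ n) ∣

-- Averaging over maximal chains, a family of density h - 1 + ε has in expectation
-- at least ε windows of h consecutive members on a chain.  Discard the windows in
-- which some set A occupies a position that it holds in too few windows, compared to
-- the number of chains through A; after two rounds a window remains.  A set A at position i
-- of a surviving window has, for every other position j, candidates comparable to A
-- that cover a positive fraction of the chains through A: so either linearly many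
-- of them are neighbours of A in the hypercube, or there are quadratically many.
-- Send u to position rank u, the length of a longest chain strictly below u.  The images of the neighbours of x are chosen greedily
-- among linearly many candidates.  In the second step greediness alone fails, as
-- about (δn)² sets are already used, but distinct parents have at most two common
-- hypercube neighbours, so linearly many candidates next to a parent remain free;
-- parents with quadratically many candidates can avoid everything.
--
-- A random maximal chain is encoded by inserting the elements of [n] one by one,
-- which makes the numbers of chains through A, and through A ⊆ B, products.

module Submission where

open import Defs

-- Windows of consecutive members are counted, rather than all subchains of F with h members,
-- because a set then occupies a given position in at most one window of each chain. Hence the
-- windows with A and B at two prescribed positions are at most as many as the chains through both
-- sets, with no factor for the members in between.
--
-- The two rounds match the radius of P. A set is tested against the windows of the preceding round,
-- so its candidates come from windows that have themselves survived one round less. `Branches`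
-- records this nested supply, and the embedding sees nothing else of the counting.
--
-- The fractions of chains have order 1/n and 1/n² only away from the two ends of the cube. Sets of
-- size below n/8 or above 7n/8 are therefore removed beforehand; they lie on so many chains each
-- that there are few of them, and half of ε pays for the removal.
--
-- Throughout, the height is `suc h`, so that positions run from 0 to `h`, and ε is replaced by 1/q
-- with a natural number `q`.

module Combinatorics where
  open import Data.Nat.Base
    using (ℕ; zero; suc; _+_; _*_; _∸_; _≤_; _<_; z≤n; s≤s; pred; _!; _^_; NonZero; >-nonZero; _/_;
      _%_; ⌊_/2⌋; ⌈_/2⌉; >-nonZero⁻¹)
  open import Data.Nat.Properties as ℕₚ using (≤-refl; ≤-trans; ≤-reflexive; +-mono-≤; _!≢0)
  open import Data.Nat.Tactic.RingSolver using (solve-∀)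
  open import Data.Bool.Base using (true; false; not)
  open import Data.List.Base
    using (List; []; _∷_; _++_; length; map; filter; cartesianProductWith; cartesianProduct;
      downFrom; tails; upTo; concatMap; allFin)
  open import Data.List.Membership.Propositional using (_∈_; _∉_; find; lose)
  open import Data.List.Membership.Propositional.Properties
    using (∈-++⁺ʳ; ∈-++⁺ˡ; ∈-++⁻; ∈-∃++; ∈-filter⁺; ∈-map⁺; ∈-map⁻; ∈-filter⁻; ∈-upTo⁺; ∈-concatMap⁻;
      ∈-cartesianProduct⁺; ∈-allFin; ∈-concatMap⁺)
  open import Data.List.Properties
    using (length-++; length-downFrom; length-map; length-filter; length-upTo; filter-accept;
      length-tabulate)
  open import Data.List.Relation.Unary.All as All using (All; []; _∷_)
  open import Data.List.Relation.Unary.All.Properties as Allₚ using (¬All⇒Any¬)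
  open import Data.List.Relation.Unary.Any as Any using (Any; here; there; any?)
  open import Data.List.Relation.Unary.AllPairs as AllPairs using (AllPairs; []; _∷_)
  open import Data.List.Relation.Unary.Unique.Propositional using (Unique)
  open import Data.Product using (Σ-syntax; ∃-syntax; ∃; _×_; _,_; proj₁; proj₂)
  open import Data.Sum using (_⊎_; inj₁; inj₂; [_,_]′; fromInj₂)
  open import Data.Empty using (⊥-elim)
  open import Relation.Nullary using (¬_; Dec; yes; no; does; _because_; contradiction; ¬?)
  open import Relation.Unary using (Decidable)
  open import Relation.Binary.Definitions using (DecidableEquality; tri<; tri≈; tri>)
  open import Relation.Binary.PropositionalEquality
    using (_≡_; _≢_; refl; sym; trans; cong; cong₂; subst; subst₂; module ≡-Reasoning)
  open import Function.Base using (_∘_; id; case_of_)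
  import Data.Bool.Properties as Boolₚ
  open import Data.Fin.Subset using (Subset; inside; outside; _⊆_; ∣_∣)
  open import Data.Fin.Subset.Properties using (∣p∣≤n; p⊆q⇒∣p∣≤∣q∣; drop-∷-⊆; s⊆s; out⊆)
  open import Data.Vec.Base using (Vec; []; _∷_)
  open import Data.Vec using (here)
  open import Data.Vec.Properties using (∷-injectiveʳ; ≡-dec; ∷-injective)
  open import Relation.Nullary.Decidable using (_×-dec_; decidable-stable)
  open import Data.Maybe.Base using (Maybe; just; nothing)
  open import Data.Maybe.Properties using () renaming (≡-dec to ≡-decᴹ)
  import Data.List.Relation.Unary.AllPairs.Properties as AllPairsₚ
  import Data.List.Relation.Unary.Unique.Propositional.Properties as Uniqueₚ
  open import Data.Nat.DivMod
    using (m/n*n≤m; m/n*n≡m; m≡m%n+[m/n]*n; m%n<n; m<n*o⇒m/o<n; +-distrib-/-∣ʳ; m<n⇒m/n≡0; m*n/n≡m)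
  open import Data.Nat.Combinatorics using (_C_; k![n∸k]!∣n!)
  open import Data.Nat.Combinatorics.Specification using (nCk≡n!/k![n-k]!)
  open import Data.Nat.Divisibility using (divides)
  open import Data.Fin.Base using (Fin; toℕ)
  open import Data.Fin.Properties using (toℕ<n; toℕ-injective) renaming (_≟_ to _≟ᶠ_; any? to anyᶠ?)
  open import Data.List.Relation.Unary.Linked using ([]; [-]; _∷_)
  open import Data.Product.Properties using () renaming (≡-dec to ≡-decˣ)
  open import Data.Unit.Base using (⊤; tt)
  open import Relation.Binary.Construct.Closure.ReflexiveTransitive using (ε; _◅_)
  open import Relation.Binary.Construct.Closure.Symmetric using (fwd; bwd; symmetric)
  import Relation.Binary.Properties.Poset as PosetProperties

  private variable
    A B X : Set
    n : ℕ

  -- Finite sums and indicators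

  ∑ : List A → (A → ℕ) → ℕ
  ∑ []       f = 0
  ∑ (x ∷ xs) f = f x + ∑ xs f

  ⟦_⟧ : {P : Set} → Dec P → ℕ
  ⟦ true  because _ ⟧ = 1
  ⟦ false because _ ⟧ = 0

  ⟦⟧≤1 : {P : Set} (d : Dec P) → ⟦ d ⟧ ≤ 1
  ⟦⟧≤1 (true  because _) = ≤-refl
  ⟦⟧≤1 (false because _) = z≤n

  ⟦⟧-yes : {P : Set} (d : Dec P) → P → ⟦ d ⟧ ≡ 1
  ⟦⟧-yes (yes _) p = refl
  ⟦⟧-yes (no ¬p) p = contradiction p ¬p

  ⟦⟧-no : {P : Set} (d : Dec P) → ¬ P → ⟦ d ⟧ ≡ 0
  ⟦⟧-no (yes p) ¬p = contradiction p ¬p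
  ⟦⟧-no (no _)  _  = refl

  ⟦⟧-mono : {P Q : Set} (d : Dec P) (e : Dec Q) → (P → Q) → ⟦ d ⟧ ≤ ⟦ e ⟧
  ⟦⟧-mono (yes p) e f = ≤-reflexive (sym (⟦⟧-yes e (f p)))
  ⟦⟧-mono (no _)  e f = z≤n

  ∑-mono-∈ : ∀ (xs : List A) {f g : A → ℕ} → (∀ {x} → x ∈ xs → f x ≤ g x) → ∑ xs f ≤ ∑ xs g
  ∑-mono-∈ []       h = z≤n
  ∑-mono-∈ (x ∷ xs) h = +-mono-≤ (h (here refl)) (∑-mono-∈ xs (h ∘ there))

  ∑-mono : ∀ (xs : List A) {f g : A → ℕ} → (∀ x → f x ≤ g x) → ∑ xs f ≤ ∑ xs g
  ∑-mono xs h = ∑-mono-∈ xs (λ {x} _ → h x)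

  ∑-cong : ∀ (xs : List A) {f g : A → ℕ} → (∀ x → f x ≡ g x) → ∑ xs f ≡ ∑ xs g
  ∑-cong []       h = refl
  ∑-cong (x ∷ xs) h = cong₂ _+_ (h x) (∑-cong xs h)

  interchange : ∀ a b c d → a + b + (c + d) ≡ a + c + (b + d)
  interchange = solve-∀

  ∑-distrib-+ : ∀ (xs : List A) (f g : A → ℕ) → ∑ xs (λ x → f x + g x) ≡ ∑ xs f + ∑ xs g
  ∑-distrib-+ []       f g = refl
  ∑-distrib-+ (x ∷ xs) f g =
    trans (cong (f x + g x +_) (∑-distrib-+ xs f g)) (interchange (f x) (g x) _ _)

  ∑-*ˡ : ∀ (xs : List A) k (f : A → ℕ) → ∑ xs (λ x → k * f x) ≡ k * ∑ xs f
  ∑-*ˡ []       k f = sym (ℕₚ.*-zeroʳ k)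
  ∑-*ˡ (x ∷ xs) k f =
    trans (cong (k * f x +_) (∑-*ˡ xs k f)) (sym (ℕₚ.*-distribˡ-+ k (f x) _))

  ∑-*ʳ : ∀ (xs : List A) k (f : A → ℕ) → ∑ xs (λ x → f x * k) ≡ ∑ xs f * k
  ∑-*ʳ []       k f = refl
  ∑-*ʳ (x ∷ xs) k f =
    trans (cong (f x * k +_) (∑-*ʳ xs k f)) (sym (ℕₚ.*-distribʳ-+ k (f x) _))

  ∑-const : ∀ (xs : List A) k → ∑ xs (λ _ → k) ≡ length xs * k
  ∑-const []       k = refl
  ∑-const (x ∷ xs) k = cong (k +_) (∑-const xs k)

  length-∑ : ∀ (xs : List A) → length xs ≡ ∑ xs (λ _ → 1)
  length-∑ xs = trans (sym (ℕₚ.*-identityʳ _)) (sym (∑-const xs 1))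

  ∑-zero : ∀ (xs : List A) → ∑ xs (λ _ → 0) ≡ 0
  ∑-zero []       = refl
  ∑-zero (x ∷ xs) = ∑-zero xs

  ∑-swap : ∀ (xs : List A) (ys : List B) (f : A → B → ℕ) →
    ∑ xs (λ x → ∑ ys (f x)) ≡ ∑ ys (λ y → ∑ xs (λ x → f x y))
  ∑-swap []       ys f = sym (∑-zero ys)
  ∑-swap (x ∷ xs) ys f =
    trans (cong (∑ ys (f x) +_) (∑-swap xs ys f)) (sym (∑-distrib-+ ys (f x) _))

  ∑-++ : ∀ (xs ys : List A) (f : A → ℕ) → ∑ (xs ++ ys) f ≡ ∑ xs f + ∑ ys f
  ∑-++ []       ys f = refl
  ∑-++ (x ∷ xs) ys f = trans (cong (f x +_) (∑-++ xs ys f)) (sym (ℕₚ.+-assoc (f x) _ _))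

  ∑-map : ∀ (g : A → B) (xs : List A) (f : B → ℕ) → ∑ (map g xs) f ≡ ∑ xs (f ∘ g)
  ∑-map g []       f = refl
  ∑-map g (x ∷ xs) f = cong (f (g x) +_) (∑-map g xs f)

  ∑-cartesianProductWith : ∀ (g : A → B → X) (xs : List A) (ys : List B) (f : X → ℕ) →
    ∑ (cartesianProductWith g xs ys) f ≡ ∑ xs (λ x → ∑ ys (λ y → f (g x y)))
  ∑-cartesianProductWith g []       ys f = refl
  ∑-cartesianProductWith g (x ∷ xs) ys f =
    trans (∑-++ (map (g x) ys) _ f)
          (cong₂ _+_ (∑-map (g x) ys f) (∑-cartesianProductWith g xs ys f))

  ∑-filter-≤ : ∀ {P : A → Set} (P? : Decidable P) (xs : List A) (f : A → ℕ) →
    ∑ (filter P? xs) f ≤ ∑ xs f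
  ∑-filter-≤ P? []       f = z≤n
  ∑-filter-≤ P? (x ∷ xs) f with does (P? x)
  ... | true  = ℕₚ.+-monoʳ-≤ (f x) (∑-filter-≤ P? xs f)
  ... | false = ≤-trans (∑-filter-≤ P? xs f) (ℕₚ.m≤n+m _ (f x))

  length-filter-∑ : ∀ {P : A → Set} (P? : Decidable P) (xs : List A) →
    length (filter P? xs) ≡ ∑ xs (λ x → ⟦ P? x ⟧)
  length-filter-∑ P? []       = refl
  length-filter-∑ P? (x ∷ xs) with P? x
  ... | yes _ = cong suc (length-filter-∑ P? xs)
  ... | no  _ = length-filter-∑ P? xs

  ∑-single : ∀ (xs : List A) (f : A → ℕ) {x} → x ∈ xs → f x ≤ ∑ xs f
  ∑-single (x ∷ xs) f (here refl) = ℕₚ.m≤m+n _ _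
  ∑-single (x ∷ xs) f (there x∈)  = ≤-trans (∑-single xs f x∈) (ℕₚ.m≤n+m _ _)

  -- A union bound in the form used for cleaning: an item that is discarded is charged to some test
  -- that it fails.
  1≤all+fails : ∀ {P : A → Set} (P? : Decidable P) (xs : List A) →
    1 ≤ ⟦ All.all? P? xs ⟧ + ∑ xs (λ x → ⟦ ¬? (P? x) ⟧)
  1≤all+fails {P = P} P? xs with All.all? P? xs
  ... | yes _   = s≤s z≤n
  ... | no ¬all = count xs (¬All⇒Any¬ P? xs ¬all)
    where
    count : ∀ xs → Any (λ x → ¬ P x) xs → 1 ≤ ∑ xs (λ x → ⟦ ¬? (P? x) ⟧)
    count (x ∷ xs) (here ¬p) = ≤-trans (≤-reflexive (sym (⟦⟧-yes (¬? (P? x)) ¬p))) (ℕₚ.m≤m+n _ _)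
    count (x ∷ xs) (there a) = ≤-trans (count xs a) (ℕₚ.m≤n+m _ _)

  -- Distinct representatives

  Unique⊆⇒length≤ : ∀ {xs ys : List A} → Unique xs → (∀ {x} → x ∈ xs → x ∈ ys) →
    length xs ≤ length ys
  Unique⊆⇒length≤ {xs = []} _ _ = z≤n
  Unique⊆⇒length≤ {xs = x ∷ xs} (x≢ ∷ u) sub with ∈-∃++ (sub (here refl))
  ... | as , bs , refl = subst (suc (length xs) ≤_) (sym len)
      (s≤s (≤-trans (Unique⊆⇒length≤ {ys = as ++ bs} u sub′) (≤-reflexive (length-++ as))))
    where
    len : length (as ++ x ∷ bs) ≡ suc (length as + length bs)
    len = trans (length-++ as) (ℕₚ.+-suc (length as) (length bs))
    sub′ : ∀ {y} → y ∈ xs → y ∈ as ++ bs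
    sub′ y∈ with ∈-++⁻ as (sub (there y∈))
    ... | inj₁ p         = ∈-++⁺ˡ p
    ... | inj₂ (here refl) = contradiction refl (All.lookup x≢ y∈)
    ... | inj₂ (there p) = ∈-++⁺ʳ as p

  module _ (_≟_ : DecidableEquality A) where
    open import Data.List.Membership.DecPropositional _≟_ using (_∈?_)

    fresh : ∀ {xs ys : List A} → Unique xs → length ys < length xs → ∃[ x ] x ∈ xs × x ∉ ys
    fresh {xs} {ys} u lt with All.all? (_∈? ys) xs
    ... | yes all = contradiction (Unique⊆⇒length≤ u (All.lookup all)) (ℕₚ.<⇒≱ lt)
    ... | no ¬all = let p = ¬All⇒Any¬ (_∈? ys) xs ¬all in Any.lookup p , find-∈ p
      where
      find-∈ : ∀ {zs} (p : Any (_∉ ys) zs) → Any.lookup p ∈ zs × Any.lookup p ∉ ys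
      find-∈ (here ¬p) = here refl , ¬p
      find-∈ (there p) = let i , o = find-∈ p in there i , o

    -- A greedy choice of distinct representatives.  Only requests j that are Served
    -- are answered; elsewhere pick j is junk.
    record Representatives {J : Set} (js : List J) (R : J → List A) (used : List A) : Set where
      Served : J → Set
      Served j = length used + length js ≤ length (R j)
      field
        pick      : J → A
        picked    : ∀ {j} → j ∈ js → Served j → pick j ∈ R j
        unused    : ∀ {j} → j ∈ js → Served j → pick j ∉ used
        injective : ∀ {j k} → j ∈ js → k ∈ js → Served j → Served k → pick j ≡ pick k → j ≡ k

    module _ {J : Set} (_≟ⱼ_ : DecidableEquality J) (default : A) where

      abstract
        representatives : (js : List J) (R : J → List A) → (∀ j → Unique (R j)) → (used : List A) →
          Representatives js R used
        representatives []       R u used = record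
          { pick = λ _ → default ; picked = λ () ; unused = λ () ; injective = λ () }
        representatives (i ∷ js) R u used = record
          { pick      = f
          ; picked    = λ j∈ s → proj₁ (fits j∈ s)
          ; unused    = λ j∈ s → proj₂ (fits j∈ s)
          ; injective = injective
          }
          where
          Served : J → Set
          Served j = length used + suc (length js) ≤ length (R j)
          -- A request without enough candidates gets `default`, which joins the used values as well
          -- and so costs the later requests no more than a proper answer.
          choice : ∃[ y ] (Served i → y ∈ R i × y ∉ used)
          choice with length used + suc (length js) ℕₚ.≤? length (R i)
          ... | yes p = let y , q = fresh (u i) (≤-trans (s≤s (ℕₚ.m≤m+n (length used) (length js)))
                                    (≤-trans (≤-reflexive (sym (ℕₚ.+-suc _ _))) p)) in y , λ _ → q
          ... | no ¬p = default , λ p → contradiction p ¬p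
          y : A
          y = proj₁ choice
          module Rest = Representatives (representatives js R u (y ∷ used))
          -- Each answer moves one unit from the pending requests to the used values, so the budget
          -- in `Served` does not change along the recursion.
          shift : ∀ {j} → Served j → length (y ∷ used) + length js ≤ length (R j)
          shift s = ≤-trans (≤-reflexive (sym (ℕₚ.+-suc _ _))) s
          f : J → A
          f j with j ≟ⱼ i
          ... | yes _ = y
          ... | no  _ = Rest.pick j
          fits : ∀ {j} → j ∈ i ∷ js → Served j → f j ∈ R j × f j ∉ used
          fits {j} j∈ s with j ≟ⱼ i
          ... | yes refl = proj₂ choice s
          fits (here refl) s | no j≢i = contradiction refl j≢i
          fits (there j∈)  s | no j≢i = Rest.picked j∈ (shift s) , Rest.unused j∈ (shift s) ∘ there
          injective : ∀ {j k} → j ∈ i ∷ js → k ∈ i ∷ js → Served j → Served k → f j ≡ f k → j ≡ k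
          injective {j} {k} j∈ k∈ s t eq with j ≟ⱼ i | k ≟ⱼ i
          ... | yes refl | yes refl = refl
          injective _ (here refl) s t eq | yes refl | no k≢i = contradiction refl k≢i
          injective _ (there k∈) s t eq | yes refl | no k≢i =
            contradiction (here (sym eq)) (Rest.unused k∈ (shift t))
          injective (here refl) _ s t eq | no j≢i | _ = contradiction refl j≢i
          injective (there j∈) _ s t eq | no j≢i | yes refl =
            contradiction (here eq) (Rest.unused j∈ (shift s))
          injective _ (here refl) s t eq | no j≢i | no k≢i = contradiction refl k≢i
          injective (there j∈) (there k∈) s t eq | no j≢i | no k≢i =
            Rest.injective j∈ k∈ (shift s) (shift t) eq

  -- Discarding every item that meets a light test: each test is charged at most
  -- once, for less than N t / K items.
  module Cleaning {W T : Set} {I : T → W → Set} (I? : ∀ t w → Dec (I t w))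
                  (tests : List T) (N : T → ℕ) (K : ℕ) where
    open import Relation.Nullary.Decidable using (_→-dec_)

    degree : List W → T → ℕ
    degree M t = ∑ M (λ w → ⟦ I? t w ⟧)

    Passes : List W → W → T → Set
    Passes M w t = I t w → N t ≤ K * degree M t

    passes? : ∀ M w t → Dec (Passes M w t)
    passes? M w t = I? t w →-dec (N t ℕₚ.≤? K * degree M t)

    clean : List W → List W
    clean M = filter (λ w → All.all? (passes? M w) tests) M

    length≤clean : ∀ M → K * length M ≤ K * length (clean M) + ∑ tests N
    length≤clean M = begin
      K * length M
        ≡⟨ cong (K *_) (length-∑ M) ⟩
      K * ∑ M (λ _ → 1)
        ≤⟨ ℕₚ.*-monoʳ-≤ K (∑-mono M λ w → 1≤all+fails (passes? M w) tests) ⟩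
      K * ∑ M (λ w → ⟦ All.all? (passes? M w) tests ⟧ + ∑ tests (λ t → ⟦ ¬? (passes? M w t) ⟧))
        ≡⟨ cong (K *_) (∑-distrib-+ M _ _) ⟩
      K * (∑ M (λ w → ⟦ All.all? (passes? M w) tests ⟧)
           + ∑ M (λ w → ∑ tests (λ t → ⟦ ¬? (passes? M w t) ⟧)))
        ≡⟨ ℕₚ.*-distribˡ-+ K _ _ ⟩
      K * ∑ M (λ w → ⟦ All.all? (passes? M w) tests ⟧)
           + K * ∑ M (λ w → ∑ tests (λ t → ⟦ ¬? (passes? M w t) ⟧))
        ≡⟨ cong₂ _+_ (cong (K *_) (sym (length-filter-∑ (λ w → All.all? (passes? M w) tests) M)))
                     (trans (cong (K *_) (∑-swap M tests _)) (sym (∑-*ˡ tests K _))) ⟩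
      K * length (clean M) + ∑ tests (λ t → K * ∑ M (λ w → ⟦ ¬? (passes? M w t) ⟧))
        ≤⟨ ℕₚ.+-monoʳ-≤ (K * length (clean M)) (∑-mono tests failures) ⟩
      K * length (clean M) + ∑ tests N ∎
      where
      open ℕₚ.≤-Reasoning
      failures : ∀ t → K * ∑ M (λ w → ⟦ ¬? (passes? M w t) ⟧) ≤ N t
      failures t with N t ℕₚ.≤? K * degree M t
      ... | yes good = ≤-trans (≤-reflexive (trans (cong (K *_) (trans
              (∑-cong M λ w → ⟦⟧-no (¬? (I? t w →-dec yes good)) (λ f → f (λ _ → good))) (∑-zero M)))
              (ℕₚ.*-zeroʳ K))) z≤n
      ... | no ¬good = ≤-trans (ℕₚ.*-monoʳ-≤ K (∑-mono M λ w →
              ⟦⟧-mono (¬? (I? t w →-dec no ¬good)) (I? t w) (recover w)))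
              (ℕₚ.<⇒≤ (ℕₚ.≰⇒> ¬good))
        where
        recover : ∀ w → ¬ (I t w → N t ≤ K * degree M t) → I t w
        recover w f with I? t w
        ... | yes i = i
        ... | no ¬i = ⊥-elim (f (λ i → contradiction i ¬i))

  -- Maximal chains

  _≟ₛ_ : DecidableEquality (Subset n)
  _≟ₛ_ = ≡-dec Boolₚ._≟_

  Chain : ℕ → Set
  Chain = Vec ℕ

  -- A maximal chain of 2^[n+1] arises from one of 2^[n] by letting the new
  -- element enter after level p: n! codes in all.
  level : Chain n → ℕ → Subset n
  level []      k = []
  level (p ∷ c) k with k ℕₚ.≤? p
  ... | yes _ = outside ∷ level c k
  ... | no  _ = inside ∷ level c (pred k)

  chains : ∀ n → List (Chain n)
  chains zero    = [] ∷ []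
  chains (suc n) = cartesianProductWith _∷_ (downFrom (suc n)) (chains n)

  level-mono : ∀ (c : Chain n) {k l} → k ≤ l → level c k ⊆ level c l
  level-mono []      k≤l = id
  level-mono (p ∷ c) {k} {l} k≤l with k ℕₚ.≤? p | l ℕₚ.≤? p
  ... | yes _   | yes _   = out⊆ (level-mono c k≤l)
  ... | yes k≤p | no  l≰p = out⊆ (level-mono c (≤-trans k≤p (ℕₚ.<⇒≤pred (ℕₚ.≰⇒> l≰p))))
  ... | no  k≰p | yes l≤p = contradiction (≤-trans k≤l l≤p) k≰p
  ... | no  _   | no  _   = s⊆s (level-mono c (ℕₚ.pred-mono-≤ k≤l))

  infix 4 _On_ _On?_

  _On_ : Subset n → Chain n → Set
  A On c = level c ∣ A ∣ ≡ A

  _On?_ : ∀ (A : Subset n) c → Dec (A On c)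
  A On? c = level c ∣ A ∣ ≟ₛ A

  -- The condition separates into one on the insertion position `p` and one on the shorter chain
  -- `c`. This is why sums over all chains factor.
  outside-On : ∀ (A : Subset n) p c → ⟦ (outside ∷ A) On? (p ∷ c) ⟧ ≡ ⟦ ∣ A ∣ ℕₚ.≤? p ⟧ * ⟦ A On? c ⟧
  outside-On A p c with (outside ∷ A) On? (p ∷ c)
  ... | r with ∣ A ∣ ℕₚ.≤? p
  ... | no  _ = ⟦⟧-no r λ ()
  ... | yes _ = trans (ℕₚ.≤-antisym (⟦⟧-mono r (A On? c) ∷-injectiveʳ)
        (⟦⟧-mono (A On? c) r (cong (outside ∷_))))
                      (sym (ℕₚ.+-identityʳ _))

  inside-On : ∀ (A : Subset n) p c → ⟦ (inside ∷ A) On? (p ∷ c) ⟧ ≡ ⟦ p ℕₚ.≤? ∣ A ∣ ⟧ * ⟦ A On? c ⟧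
  inside-On A p c with (inside ∷ A) On? (p ∷ c)
  ... | r with suc ∣ A ∣ ℕₚ.≤? p
  ... | yes a<p = trans (⟦⟧-no r λ ()) (cong (_* ⟦ A On? c ⟧) (sym (⟦⟧-no (p ℕₚ.≤? ∣ A ∣) (ℕₚ.<⇒≱ a<p))))
  ... | no  a≮p = trans (ℕₚ.≤-antisym (⟦⟧-mono r (A On? c) ∷-injectiveʳ)
        (⟦⟧-mono (A On? c) r (cong (inside ∷_))))
                   (trans (sym (ℕₚ.+-identityʳ _))
                          (cong (_* ⟦ A On? c ⟧) (sym (⟦⟧-yes (p ℕₚ.≤? ∣ A ∣) (ℕₚ.≮⇒≥ a≮p)))))

  count-initial : ∀ m hi → hi < m → ∑ (downFrom m) (λ p → ⟦ p ℕₚ.≤? hi ⟧) ≡ suc hi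
  count-initial (suc m) hi (s≤s hi≤m) with m ℕₚ.≤? hi
  ... | no m≰hi = count-initial m hi (ℕₚ.≰⇒> m≰hi)
  ... | yes m≤hi with ℕₚ.≤-antisym hi≤m m≤hi
  ...   | refl = cong suc (all m ≤-refl)
    where
    all : ∀ k → k ≤ m → ∑ (downFrom k) (λ p → ⟦ p ℕₚ.≤? m ⟧) ≡ k
    all zero    k≤m = refl
    all (suc k) k≤m = cong₂ _+_ (⟦⟧-yes (k ℕₚ.≤? m) (ℕₚ.<⇒≤ k≤m)) (all k (ℕₚ.<⇒≤ k≤m))

  count-final : ∀ m lo → ∑ (downFrom m) (λ p → ⟦ lo ℕₚ.≤? p ⟧) ≡ m ∸ lo
  count-final zero    lo = sym (ℕₚ.0∸n≡0 lo)
  count-final (suc m) lo with lo ℕₚ.≤? m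
  ... | yes lo≤m = trans (cong suc (count-final m lo)) (sym (ℕₚ.+-∸-assoc 1 lo≤m))
  ... | no  lo≰m = trans (count-final m lo) (trans (ℕₚ.m≤n⇒m∸n≡0 (ℕₚ.<⇒≤ (ℕₚ.≰⇒> lo≰m)))
                         (sym (ℕₚ.m≤n⇒m∸n≡0 (ℕₚ.≰⇒> lo≰m))))

  count-between : ∀ m lo hi → ∑ (downFrom m) (λ p → ⟦ lo ℕₚ.≤? p ⟧ * ⟦ p ℕₚ.≤? hi ⟧) ≤ suc hi ∸ lo
  count-between zero    lo hi = z≤n
  count-between (suc m) lo hi with lo ℕₚ.≤? m | m ℕₚ.≤? hi
  ... | no  _    | _      = count-between m lo hi
  ... | yes _    | no  _  = count-between m lo hi
  ... | yes lo≤m | yes m≤hi = ≤-trans (s≤s (≤-trans (∑-mono (downFrom m)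
          (λ p → ≤-trans (ℕₚ.*-monoʳ-≤ ⟦ lo ℕₚ.≤? p ⟧ (⟦⟧≤1 (p ℕₚ.≤? hi)))
                (≤-reflexive (ℕₚ.*-identityʳ _))))
          (≤-reflexive (count-final m lo))))
          (≤-trans (≤-reflexive (sym (ℕₚ.+-∸-assoc 1 lo≤m))) (ℕₚ.∸-monoˡ-≤ lo (s≤s m≤hi)))

  chainsThrough : Subset n → ℕ
  chainsThrough {n} A = ∑ (chains n) (λ c → ⟦ A On? c ⟧)

  chainsThroughBoth : Subset n → Subset n → ℕ
  chainsThroughBoth {n} A B = ∑ (chains n) (λ c → ⟦ A On? c ⟧ * ⟦ B On? c ⟧)

  ∑-product : ∀ {X Y : Set} (xs : List X) (ys : List Y) (f : X → ℕ) (g : Y → ℕ) →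
    ∑ xs (λ x → ∑ ys (λ y → f x * g y)) ≡ ∑ xs f * ∑ ys g
  ∑-product xs ys f g = trans (∑-cong xs (λ x → ∑-*ˡ ys (f x) g)) (∑-*ʳ xs (∑ ys g) f)

  ∑-chains : (f : ℕ → Chain n → ℕ) {g : Chain (suc n) → ℕ} → (∀ p c → g (p ∷ c) ≡ f p c) →
    ∑ (chains (suc n)) g ≡ ∑ (downFrom (suc n)) (λ p → ∑ (chains n) (f p))
  ∑-chains {n} f {g} eq = trans (∑-cartesianProductWith _∷_ (downFrom (suc n)) (chains n) g)
    (∑-cong (downFrom (suc n)) (λ p → ∑-cong (chains n) (eq p)))

  length-chains : ∀ n → length (chains n) ≡ n !
  length-chains zero    = refl
  length-chains (suc n) = begin
    length (chains (suc n))                 ≡⟨ length-∑ (chains (suc n)) ⟩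
    ∑ (chains (suc n)) (λ _ → 1)            ≡⟨ ∑-chains {n} (λ _ _ → 1) (λ _ _ → refl) ⟩
    ∑ (downFrom (suc n)) (λ _ → ∑ (chains n) (λ _ → 1))
      ≡⟨ ∑-cong (downFrom (suc n)) (λ _ → trans (sym (length-∑ (chains n))) (length-chains n)) ⟩
    ∑ (downFrom (suc n)) (λ _ → n !)        ≡⟨ ∑-const (downFrom (suc n)) (n !) ⟩
    length (downFrom (suc n)) * n !         ≡⟨ cong (_* n !) (length-downFrom (suc n)) ⟩
    suc n ! ∎
    where
    open ≡-Reasoning

  private
    pull-first : ∀ a b c → a * (b * c) ≡ b * (a * c)
    pull-first = solve-∀

  chainsThrough≡ : (A : Subset n) → chainsThrough A ≡ ∣ A ∣ ! * (n ∸ ∣ A ∣) !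
  chainsThrough≡ [] = refl
  chainsThrough≡ {suc n} (outside ∷ A) = begin
    chainsThrough (outside ∷ A)
      ≡⟨ ∑-chains {n} (λ p c → ⟦ ∣ A ∣ ℕₚ.≤? p ⟧ * ⟦ A On? c ⟧) (outside-On A) ⟩
    ∑ (downFrom (suc n)) (λ p → ∑ (chains n) (λ c → ⟦ ∣ A ∣ ℕₚ.≤? p ⟧ * ⟦ A On? c ⟧))
      ≡⟨ ∑-product (downFrom (suc n)) (chains n) (λ p → ⟦ ∣ A ∣ ℕₚ.≤? p ⟧) (λ c → ⟦ A On? c ⟧) ⟩
    ∑ (downFrom (suc n)) (λ p → ⟦ ∣ A ∣ ℕₚ.≤? p ⟧) * chainsThrough A
      ≡⟨ cong₂ _*_ (trans (count-final (suc n) ∣ A ∣) e) (chainsThrough≡ A) ⟩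
    suc (n ∸ ∣ A ∣) * (∣ A ∣ ! * (n ∸ ∣ A ∣) !)
      ≡⟨ pull-first (suc (n ∸ ∣ A ∣)) (∣ A ∣ !) ((n ∸ ∣ A ∣) !) ⟩
    ∣ A ∣ ! * suc (n ∸ ∣ A ∣) !
      ≡⟨ cong (λ m → ∣ A ∣ ! * m !) (sym e) ⟩
    ∣ A ∣ ! * (suc n ∸ ∣ A ∣) ! ∎
    where
    open ≡-Reasoning
    e : suc n ∸ ∣ A ∣ ≡ suc (n ∸ ∣ A ∣)
    e = ℕₚ.+-∸-assoc 1 (∣p∣≤n A)
  chainsThrough≡ {suc n} (inside ∷ A) = begin
    chainsThrough (inside ∷ A)
      ≡⟨ ∑-chains {n} (λ p c → ⟦ p ℕₚ.≤? ∣ A ∣ ⟧ * ⟦ A On? c ⟧) (inside-On A) ⟩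
    ∑ (downFrom (suc n)) (λ p → ∑ (chains n) (λ c → ⟦ p ℕₚ.≤? ∣ A ∣ ⟧ * ⟦ A On? c ⟧))
      ≡⟨ ∑-product (downFrom (suc n)) (chains n) (λ p → ⟦ p ℕₚ.≤? ∣ A ∣ ⟧) (λ c → ⟦ A On? c ⟧) ⟩
    ∑ (downFrom (suc n)) (λ p → ⟦ p ℕₚ.≤? ∣ A ∣ ⟧) * chainsThrough A
      ≡⟨ cong₂ _*_ (count-initial (suc n) ∣ A ∣ (s≤s (∣p∣≤n A))) (chainsThrough≡ A) ⟩
    suc ∣ A ∣ * (∣ A ∣ ! * (n ∸ ∣ A ∣) !)
      ≡⟨ sym (ℕₚ.*-assoc (suc ∣ A ∣) (∣ A ∣ !) _) ⟩
    suc ∣ A ∣ ! * (n ∸ ∣ A ∣) ! ∎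
    where open ≡-Reasoning

  private
    interleave : ∀ a b c d → a * c * (b * d) ≡ a * b * (c * d)
    interleave = solve-∀
    absorb₁ : ∀ f x y z → f * (x * y * z) ≡ f * x * y * z
    absorb₁ = solve-∀
    absorb₂ : ∀ f x y z → f * (x * y * z) ≡ x * (f * y) * z
    absorb₂ = solve-∀
    absorb₃ : ∀ f x y z → f * (x * y * z) ≡ x * y * (f * z)
    absorb₃ = solve-∀

    ∑-chainsThroughBoth : (A B : Subset n) (f g : ℕ → ℕ) {A′ B′ : Subset (suc n)} {k : ℕ} →
      (∀ p c → ⟦ A′ On? (p ∷ c) ⟧ ≡ f p * ⟦ A On? c ⟧) →
      (∀ p c → ⟦ B′ On? (p ∷ c) ⟧ ≡ g p * ⟦ B On? c ⟧) →
      ∑ (downFrom (suc n)) (λ p → f p * g p) ≤ k →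
      ∀ {m} → chainsThroughBoth A B ≤ m →
      chainsThroughBoth A′ B′ ≤ k * m
    ∑-chainsThroughBoth {n} A B f g {A′} {B′} fA gB bound bound′ = ≤-trans (≤-reflexive (trans
      (∑-chains {n} (λ p c → f p * g p * (⟦ A On? c ⟧ * ⟦ B On? c ⟧))
         (λ p c → trans (cong₂ _*_ (fA p c) (gB p c)) (interleave (f p) (g p) ⟦ A On? c ⟧ _)))
      (∑-product (downFrom (suc n)) (chains n) (λ p → f p * g p) (λ c → ⟦ A On? c ⟧ * ⟦ B On? c ⟧))))
      (ℕₚ.*-mono-≤ bound bound′)

  -- The three factorials come from the three ranges of the insertion position: up to |A| for a new
  -- element of A, from |A| to |B| for one of B outside A, and from |B| on for the others, with the
  -- sizes taken before the insertion.
  chainsThroughBoth≤ : (A B : Subset n) → A ⊆ B →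
    chainsThroughBoth A B ≤ ∣ A ∣ ! * (∣ B ∣ ∸ ∣ A ∣) ! * (n ∸ ∣ B ∣) !
  chainsThroughBoth≤ [] [] _ = ≤-refl
  chainsThroughBoth≤ {suc n} (outside ∷ A) (outside ∷ B) A⊆B = ≤-trans
    (∑-chainsThroughBoth A B (λ p → ⟦ ∣ A ∣ ℕₚ.≤? p ⟧) (λ p → ⟦ ∣ B ∣ ℕₚ.≤? p ⟧) (outside-On A)
          (outside-On B)
      (≤-trans (∑-mono (downFrom (suc n)) λ p → ≤-trans
            (ℕₚ.*-monoˡ-≤ ⟦ ∣ B ∣ ℕₚ.≤? p ⟧ (⟦⟧≤1 (∣ A ∣ ℕₚ.≤? p)))
                   (≤-reflexive (ℕₚ.+-identityʳ _)))
               (≤-reflexive (trans (count-final (suc n) ∣ B ∣) e)))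
      (chainsThroughBoth≤ A B (drop-∷-⊆ A⊆B)))
    (≤-reflexive (trans (absorb₃ (suc (n ∸ ∣ B ∣)) (∣ A ∣ !) ((∣ B ∣ ∸ ∣ A ∣) !) _)
                        (cong (λ m → ∣ A ∣ ! * (∣ B ∣ ∸ ∣ A ∣) ! * m !) (sym e))))
    where
    e : suc n ∸ ∣ B ∣ ≡ suc (n ∸ ∣ B ∣)
    e = ℕₚ.+-∸-assoc 1 (∣p∣≤n B)
  chainsThroughBoth≤ {suc n} (outside ∷ A) (inside ∷ B) A⊆B = ≤-trans
    (∑-chainsThroughBoth A B (λ p → ⟦ ∣ A ∣ ℕₚ.≤? p ⟧) (λ p → ⟦ p ℕₚ.≤? ∣ B ∣ ⟧) (outside-On A)
          (inside-On B)
      (≤-trans (count-between (suc n) ∣ A ∣ ∣ B ∣) (≤-reflexive e))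
      (chainsThroughBoth≤ A B (drop-∷-⊆ A⊆B)))
    (≤-reflexive (trans (absorb₂ (suc (∣ B ∣ ∸ ∣ A ∣)) (∣ A ∣ !) ((∣ B ∣ ∸ ∣ A ∣) !) _)
                        (cong (λ m → ∣ A ∣ ! * m ! * (n ∸ ∣ B ∣) !) (sym e))))
    where
    e : suc ∣ B ∣ ∸ ∣ A ∣ ≡ suc (∣ B ∣ ∸ ∣ A ∣)
    e = ℕₚ.+-∸-assoc 1 (p⊆q⇒∣p∣≤∣q∣ (drop-∷-⊆ A⊆B))
  chainsThroughBoth≤ {suc n} (inside ∷ A) (outside ∷ B) A⊆B = contradiction (A⊆B here) λ ()
  chainsThroughBoth≤ {suc n} (inside ∷ A) (inside ∷ B) A⊆B = ≤-trans
    (∑-chainsThroughBoth A B (λ p → ⟦ p ℕₚ.≤? ∣ A ∣ ⟧) (λ p → ⟦ p ℕₚ.≤? ∣ B ∣ ⟧) (inside-On A) (inside-On B)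
      (≤-trans (∑-mono (downFrom (suc n)) λ p → ≤-trans
            (ℕₚ.*-monoʳ-≤ ⟦ p ℕₚ.≤? ∣ A ∣ ⟧ (⟦⟧≤1 (p ℕₚ.≤? ∣ B ∣)))
                   (≤-reflexive (ℕₚ.*-identityʳ _)))
               (≤-reflexive (count-initial (suc n) ∣ A ∣ (s≤s (∣p∣≤n A)))))
      (chainsThroughBoth≤ A B (drop-∷-⊆ A⊆B)))
    (≤-reflexive (absorb₁ (suc ∣ A ∣) (∣ A ∣ !) ((∣ B ∣ ∸ ∣ A ∣) !) _))

  -- Neighbours in the hypercube

  module _ {n : ℕ} where
    open import Data.List.Membership.DecPropositional (_≟ₛ_ {n}) public using (_∈?_)

  neighbours : Subset n → List (Subset n)
  neighbours []      = []
  neighbours (b ∷ A) = (not b ∷ A) ∷ map (b ∷_) (neighbours A)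

  length-neighbours : (A : Subset n) → length (neighbours A) ≡ n
  length-neighbours []      = refl
  length-neighbours (b ∷ A) = cong suc (trans (length-map (b ∷_) (neighbours A)) (length-neighbours A))

  ⊆∧∣∣≡⇒≡ : (A B : Subset n) → A ⊆ B → ∣ B ∣ ≡ ∣ A ∣ → A ≡ B
  ⊆∧∣∣≡⇒≡ []            []            _   _ = refl
  ⊆∧∣∣≡⇒≡ (outside ∷ A) (outside ∷ B) A⊆B e = cong (outside ∷_) (⊆∧∣∣≡⇒≡ A B (drop-∷-⊆ A⊆B) e)
  ⊆∧∣∣≡⇒≡ (inside ∷ A)  (inside ∷ B)  A⊆B e =
        cong (inside ∷_) (⊆∧∣∣≡⇒≡ A B (drop-∷-⊆ A⊆B) (ℕₚ.suc-injective e))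
  ⊆∧∣∣≡⇒≡ (inside ∷ A)  (outside ∷ B) A⊆B e = contradiction (A⊆B here) λ ()
  ⊆∧∣∣≡⇒≡ (outside ∷ A) (inside ∷ B)  A⊆B e =
    contradiction (p⊆q⇒∣p∣≤∣q∣ (drop-∷-⊆ A⊆B)) (ℕₚ.<⇒≱ (ℕₚ.≤-reflexive e))

  covered⇒neighbour : (A B : Subset n) → A ⊆ B → ∣ B ∣ ≡ suc ∣ A ∣ → B ∈ neighbours A × A ∈ neighbours B
  covered⇒neighbour []            []            _   ()
  covered⇒neighbour (outside ∷ A) (outside ∷ B) A⊆B e =
    let p , q = covered⇒neighbour A B (drop-∷-⊆ A⊆B) e
    in there (∈-map⁺ _ p) , there (∈-map⁺ _ q)
  covered⇒neighbour (inside ∷ A)  (inside ∷ B)  A⊆B e =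
    let p , q = covered⇒neighbour A B (drop-∷-⊆ A⊆B) (ℕₚ.suc-injective e)
    in there (∈-map⁺ _ p) , there (∈-map⁺ _ q)
  covered⇒neighbour (inside ∷ A)  (outside ∷ B) A⊆B e = contradiction (A⊆B here) λ ()
  covered⇒neighbour (outside ∷ A) (inside ∷ B)  A⊆B e
    with ⊆∧∣∣≡⇒≡ A B (drop-∷-⊆ A⊆B) (ℕₚ.suc-injective e)
  ... | refl = here refl , here refl

  -- A list that contains all common neighbours of two distinct sets; its entries need not be
  -- neighbours of both. At the first coordinate where the sets differ, a common neighbour takes its
  -- value from one set and all later coordinates from the other. For equal sets the list is empty.
  commonNeighbours : Subset n → Subset n → List (Subset n)
  commonNeighbours []      []       = []
  commonNeighbours (a ∷ A) (b ∷ B) with a Boolₚ.≟ b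
  ... | yes _ = map (a ∷_) (commonNeighbours A B)
  ... | no  _ = (a ∷ B) ∷ (b ∷ A) ∷ []

  length-commonNeighbours : (A B : Subset n) → length (commonNeighbours A B) ≤ 2
  length-commonNeighbours []      []      = z≤n
  length-commonNeighbours (a ∷ A) (b ∷ B) with a Boolₚ.≟ b
  ... | yes _ = ≤-trans (≤-reflexive (length-map (a ∷_) (commonNeighbours A B)))
        (length-commonNeighbours A B)
  ... | no  _ = ≤-refl

  ∈-commonNeighbours : {A B C : Subset n} → A ≢ B → C ∈ neighbours A → C ∈ neighbours B →
    C ∈ commonNeighbours A B
  ∈-commonNeighbours {A = a ∷ A} {b ∷ B} A≢B CA CB with a Boolₚ.≟ b
  ∈-commonNeighbours A≢B (here refl) (here e) | yes refl = contradiction (cong (_ ∷_) (∷-injectiveʳ e)) A≢B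
  ∈-commonNeighbours A≢B (here refl) (there CB) | yes refl with ∈-map⁻ _ CB
  ... | _ , _ , e = contradiction (sym (proj₁ (∷-injective e))) (Boolₚ.not-¬ refl)
  ∈-commonNeighbours A≢B (there CA) (here refl) | yes refl with ∈-map⁻ _ CA
  ... | _ , _ , e = contradiction (sym (proj₁ (∷-injective e))) (Boolₚ.not-¬ refl)
  ∈-commonNeighbours A≢B (there CA) (there CB) | yes refl with ∈-map⁻ _ CA | ∈-map⁻ _ CB
  ... | _ , p , refl | _ , q , e with ∷-injectiveʳ e
  ... | refl = ∈-map⁺ _ (∈-commonNeighbours (A≢B ∘ cong (_ ∷_)) p q)
  ∈-commonNeighbours {A = a ∷ A} {b ∷ B} A≢B (here refl) (here e) | no a≢b =
    contradiction (Boolₚ.not-injective (proj₁ (∷-injective e))) a≢b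
  ∈-commonNeighbours {A = a ∷ A} {b ∷ B} A≢B (here refl) (there CB) | no a≢b with ∈-map⁻ _ CB
  ... | _ , _ , e = there (here (cong (_∷ A) (proj₁ (∷-injective e))))
  ∈-commonNeighbours {A = a ∷ A} {b ∷ B} A≢B (there CA) (here refl) | no a≢b with ∈-map⁻ _ CA
  ... | _ , _ , e = here (cong (_∷ B) (proj₁ (∷-injective e)))
  ∈-commonNeighbours {A = a ∷ A} {b ∷ B} A≢B (there CA) (there CB) | no a≢b with ∈-map⁻ _ CA | ∈-map⁻ _ CB
  ... | _ , p , refl | _ , q , e = contradiction (proj₁ (∷-injective e)) a≢b

  -- Windows

  nth : ℕ → List X → Maybe X
  nth i       []       = nothing
  nth zero    (x ∷ xs) = just x
  nth (suc i) (x ∷ xs) = nth i xs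

  nth-∈ : ∀ i (xs : List X) {x} → nth i xs ≡ just x → x ∈ xs
  nth-∈ zero    (x ∷ xs) refl = here refl
  nth-∈ (suc i) (x ∷ xs) e    = there (nth-∈ i xs e)

  nth-< : ∀ {i} (xs : List X) → i < length xs → ∃[ x ] nth i xs ≡ just x
  nth-< {i = zero}  (x ∷ xs) _       = x , refl
  nth-< {i = suc i} (x ∷ xs) (s≤s p) = nth-< xs p

  nth-AllPairs : ∀ {R : X → X → Set} {i j} (xs : List X) {x y} → AllPairs R xs → i < j →
    nth i xs ≡ just x → nth j xs ≡ just y → R x y
  nth-AllPairs {i = zero}  {suc j} (x ∷ xs) (r ∷ _)  _       refl e′ = All.lookup r (nth-∈ j xs e′)
  nth-AllPairs {i = suc i} {suc j} (x ∷ xs) (_ ∷ rs) (s≤s p) e    e′ = nth-AllPairs xs rs p e e′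

  tails-All : ∀ {P : X → Set} {xs ys} → ys ∈ tails xs → All P xs → All P ys
  tails-All {xs = []}     (here refl) ps       = ps
  tails-All {xs = x ∷ xs} (here refl) ps       = ps
  tails-All {xs = x ∷ xs} (there ys∈) (_ ∷ ps) = tails-All ys∈ ps

  tails-AllPairs : ∀ {R : X → X → Set} {xs ys} → ys ∈ tails xs → AllPairs R xs → AllPairs R ys
  tails-AllPairs {xs = []}     (here refl) rs       = rs
  tails-AllPairs {xs = x ∷ xs} (here refl) rs       = rs
  tails-AllPairs {xs = x ∷ xs} (there ys∈) (_ ∷ rs) = tails-AllPairs ys∈ rs

  module _ (_≟_ : DecidableEquality X) where

    nth≟ : ∀ i (ys : List X) x → Dec (nth i ys ≡ just x)
    nth≟ i ys x = ≡-decᴹ _≟_ (nth i ys) (just x)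

    ∑-tails-suc : ∀ i xs x z → ∑ (tails (z ∷ xs)) (λ ys → ⟦ nth≟ (suc i) ys x ⟧) ≡ ∑ (tails xs) (λ ys →
          ⟦ nth≟ i ys x ⟧)
    ∑-tails-suc i []       x z = refl
    ∑-tails-suc i (y ∷ xs) x z = cong (⟦ nth≟ i (y ∷ xs) x ⟧ +_) (∑-tails-suc i xs x y)

    ∑-tails-zero : ∀ xs {x} → Unique xs → ∑ (tails xs) (λ ys → ⟦ nth≟ zero ys x ⟧) ≤ 1
    ∑-tails-zero []       u = z≤n
    ∑-tails-zero (y ∷ xs) {x} (y∉ ∷ u) with y ≟ x
    ... | no  _    = ∑-tails-zero xs u
    ... | yes refl = s≤s (≤-reflexive (absent xs y∉))
      where
      absent : ∀ xs → All (y ≢_) xs → ∑ (tails xs) (λ ys → ⟦ nth≟ zero ys y ⟧) ≡ 0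
      absent []       _          = refl
      absent (z ∷ xs) (y≢z ∷ y∉) with z ≟ y
      ... | yes z≡y = contradiction (sym z≡y) y≢z
      ... | no  _   = absent xs y∉

    -- Without repetitions in `xs`, the entry at position `i` of a tail determines where the tail
    -- begins.
    ∑-tails-nth : ∀ i xs {x} → Unique xs → ∑ (tails xs) (λ ys → ⟦ nth≟ i ys x ⟧) ≤ 1
    ∑-tails-nth zero    xs       u       = ∑-tails-zero xs u
    ∑-tails-nth (suc i) []       u       = z≤n
    ∑-tails-nth (suc i) (z ∷ xs) {x} (_ ∷ u) =
          ≤-trans (≤-reflexive (∑-tails-suc i xs x z)) (∑-tails-nth i xs u)

  -- A window of h + 1 consecutive entries is represented by the tail that
  -- begins with it.
  windows : ℕ → List X → List (List X)
  windows h xs = filter (λ ys → suc h ℕₚ.≤? length ys) (tails xs)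

  -- At most `h` nonempty tails are too short to begin a window. Averaged over the chains, this loss
  -- is the part of the density that the excess ε must come on top of.
  length≤windows : ∀ h (xs : List X) → length xs ≤ h + length (windows h xs)
  length≤windows h []       = z≤n
  length≤windows h (x ∷ xs) with suc h ℕₚ.≤? length (x ∷ xs)
  ... | yes p = subst (λ ws → suc (length xs) ≤ h + length ws)
    (sym (filter-accept (λ ys → suc h ℕₚ.≤? length ys) {xs = tails xs} p))
    (≤-trans (s≤s (length≤windows h xs)) (≤-reflexive (sym (ℕₚ.+-suc h _))))
  ... | no ¬p = ≤-trans (ℕₚ.≤-pred (ℕₚ.≰⇒> ¬p)) (ℕₚ.m≤m+n h _)

  infix 4 _⊏_

  _⊏_ : Subset n → Subset n → Set
  A ⊏ B = A ⊆ B × ∣ A ∣ < ∣ B ∣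

  ⊏⇒≢ : {A B : Subset n} → A ⊏ B → A ≢ B
  ⊏⇒≢ (_ , lt) refl = ℕₚ.<-irrefl refl lt

  module _ (F : List (Subset n)) (c : Chain n) where

    private
      -- A code may be any vector of numbers, so the size of a level is tested along with
      -- membership; this makes sizes increase strictly along the trace.
      met? : ∀ k → Dec (∣ level c k ∣ ≡ k × level c k ∈ F)
      met? k = (∣ level c k ∣ ℕₚ.≟ k) ×-dec (level c k ∈? F)

      metLevels : List ℕ
      metLevels = filter met? (upTo (suc n))

    trace : List (Subset n)
    trace = map (level c) metLevels

    ∈-trace⁺ : ∀ {A} → A ∈ F → A On c → A ∈ trace
    ∈-trace⁺ {A} A∈F on = subst (_∈ trace) on (∈-map⁺ (level c)
      (∈-filter⁺ met? (∈-upTo⁺ (s≤s (∣p∣≤n A))) (cong ∣_∣ on , subst (_∈ F) (sym on) A∈F)))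

    ∈-trace⁻ : ∀ {A} → A ∈ trace → A ∈ F × A On c
    ∈-trace⁻ A∈ with ∈-map⁻ (level c) A∈
    ... | k , k∈ , refl with ∈-filter⁻ met? {xs = upTo (suc n)} k∈
    ...   | _ , size , k∈F = k∈F , cong (level c) size

    trace-sorted : AllPairs _⊏_ trace
    trace-sorted = AllPairsₚ.map⁺ (increasing (Allₚ.all-filter met? (upTo (suc n)))
      (AllPairsₚ.filter⁺ met? (AllPairsₚ.applyUpTo⁺₁ id (suc n) (λ i<j _ → i<j))))
      where
      increasing : ∀ {ks} → All (λ k → ∣ level c k ∣ ≡ k × level c k ∈ F) ks → AllPairs _<_ ks →
        AllPairs (λ k l → level c k ⊏ level c l) ks
      increasing []              []       = []
      increasing (_∷_ {x = k} (e , _) met) (ls ∷ s) = All.zipWith below (met , ls) ∷ increasing met s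
        where
        below : ∀ {l} → (∣ level c l ∣ ≡ l × level c l ∈ F) × k < l → level c k ⊏ level c l
        below ((e′ , _) , k<l) = level-mono c (ℕₚ.<⇒≤ k<l) , subst₂ _<_ (sym e) (sym e′) k<l

    trace-unique : Unique trace
    trace-unique = AllPairs.map ⊏⇒≢ trace-sorted

    length-trace : length trace ≤ suc n
    length-trace = ≤-trans (≤-reflexive (length-map (level c) metLevels))
      (≤-trans (length-filter met? (upTo (suc n))) (≤-reflexive (length-upTo (suc n))))

    on≤trace : Unique F → ∑ F (λ A → ⟦ A On? c ⟧) ≤ length trace
    on≤trace u = ≤-trans (≤-reflexive (sym (length-filter-∑ (_On? c) F)))
      (Unique⊆⇒length≤ (Uniqueₚ.filter⁺ (_On? c) u)
        (λ A∈ → let A∈F , on = ∈-filter⁻ (_On? c) {xs = F} A∈ in ∈-trace⁺ A∈F on))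

  ∑-chainsThrough≤∑-trace : (F : List (Subset n)) → Unique F →
    ∑ F chainsThrough ≤ ∑ (chains n) (λ c → length (trace F c))
  ∑-chainsThrough≤∑-trace {n} F u = ≤-trans
    (≤-reflexive (∑-swap F (chains n) (λ A c → ⟦ A On? c ⟧)))
    (∑-mono (chains n) (λ c → on≤trace F c u))

  ∑-concatMap : ∀ {Y : Set} (g : X → List Y) xs (f : Y → ℕ) → ∑ (concatMap g xs) f ≡ ∑ xs (λ x → ∑ (g x) f)
  ∑-concatMap g []       f = refl
  ∑-concatMap g (x ∷ xs) f = trans (∑-++ (g x) (concatMap g xs) f)
        (cong (∑ (g x) f +_) (∑-concatMap g xs f))

  Window : ℕ → Set
  Window n = Chain n × List (Subset n)

  infix 4 _At_ _At?_

  _At_ : ℕ × Subset n → Window n → Set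
  (i , A) At (_ , ys) = nth i ys ≡ just A

  _At?_ : ∀ (t : ℕ × Subset n) w → Dec (t At w)
  (i , A) At? (_ , ys) = nth≟ _≟ₛ_ i ys A

  module _ (F : List (Subset n)) (h : ℕ) where

    windowsOn : Chain n → List (Window n)
    windowsOn c = map (c ,_) (windows h (trace F c))

    allWindows : List (Window n)
    allWindows = concatMap windowsOn (chains n)

    ∈-allWindows⁻ : ∀ {c ys} → (c , ys) ∈ allWindows → h < length ys × ys ∈ tails (trace F c)
    ∈-allWindows⁻ w∈ with Any.satisfied (∈-concatMap⁻ windowsOn {xs = chains n} w∈)
    ... | c , w∈c with ∈-map⁻ (c ,_) w∈c
    ...   | ys , ys∈ , refl with ∈-filter⁻ (λ ys → suc h ℕₚ.≤? length ys) {xs = tails (trace F c)} ys∈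
    ...     | p , q = q , p

    At-∈ : ∀ {i A w} → w ∈ allWindows → (i , A) At w → A ∈ F × A On proj₁ w
    At-∈ {i} {w = c , ys} w∈ e = All.lookup
      (tails-All (proj₂ (∈-allWindows⁻ w∈)) (All.tabulate (∈-trace⁻ F c))) (nth-∈ i ys e)

    At-⊏ : ∀ {i j A B w} → w ∈ allWindows → i < j → (i , A) At w → (j , B) At w → A ⊏ B
    At-⊏ {w = c , ys} w∈ i<j =
      nth-AllPairs ys (tails-AllPairs (proj₂ (∈-allWindows⁻ w∈)) (trace-sorted F c)) i<j

    At-defined : ∀ {j w} → w ∈ allWindows → j ≤ h → ∃[ B ] (j , B) At w
    At-defined {w = c , ys} w∈ j≤h = nth-< ys (≤-trans (s≤s j≤h) (proj₁ (∈-allWindows⁻ w∈)))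

    ∑-trace≤allWindows : ∑ (chains n) (λ c → length (trace F c)) ≤ h * length (chains n) + length allWindows
    ∑-trace≤allWindows = begin
      ∑ (chains n) (λ c → length (trace F c))
        ≤⟨ ∑-mono (chains n) (λ c → length≤windows h (trace F c)) ⟩
      ∑ (chains n) (λ c → h + length (windows h (trace F c)))
        ≡⟨ ∑-distrib-+ (chains n) (λ _ → h) _ ⟩
      ∑ (chains n) (λ _ → h) + ∑ (chains n) (λ c → length (windows h (trace F c)))
        ≡⟨ cong₂ _+_ (trans (∑-const (chains n) h) (ℕₚ.*-comm _ h))
             (trans (∑-cong (chains n) (λ c → trans (sym (length-map (c ,_) (windows h (trace F c))))
                   (length-∑ (windowsOn c))))
               (trans (sym (∑-concatMap windowsOn (chains n) (λ _ → 1))) (sym (length-∑ allWindows)))) ⟩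
      h * length (chains n) + length allWindows ∎
      where open ℕₚ.≤-Reasoning

    -- Only chains through both sets contribute, and on each of them at most one window has `A` at
    -- position `i`.
    ∑-At-pair : ∀ i j A B → ∑ allWindows (λ w →
          ⟦ (i , A) At? w ⟧ * ⟦ (j , B) At? w ⟧) ≤ chainsThroughBoth A B
    ∑-At-pair i j A B = ≤-trans
      (≤-reflexive (∑-concatMap windowsOn (chains n) _))
      (∑-mono (chains n) (λ c → ≤-trans (≤-reflexive (∑-map (c ,_) (windows h (trace F c)) _)) (onChain c)))
      where
      onChain : ∀ c → ∑ (windows h (trace F c)) (λ ys → ⟦ nth≟ _≟ₛ_ i ys A ⟧ * ⟦ nth≟ _≟ₛ_ j ys B ⟧)
                      ≤ ⟦ A On? c ⟧ * ⟦ B On? c ⟧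
      onChain c = ≤-trans (∑-filter-≤ (λ ys → suc h ℕₚ.≤? length ys) (tails (trace F c)) _)
            (bound (A On? c) (B On? c))
        where
        absent : ∀ i {A} → ¬ A On c → ∀ {ys} → ys ∈ tails (trace F c) → ⟦ nth≟ _≟ₛ_ i ys A ⟧ ≡ 0
        absent i {A} ¬on {ys} ys∈ = ⟦⟧-no (nth≟ _≟ₛ_ i ys A) (λ e → ¬on (proj₂ (All.lookup
          (tails-All ys∈ (All.tabulate (∈-trace⁻ F c))) (nth-∈ i ys e))))
        bound : (a : Dec (A On c)) (b : Dec (B On c)) →
          ∑ (tails (trace F c)) (λ ys → ⟦ nth≟ _≟ₛ_ i ys A ⟧ * ⟦ nth≟ _≟ₛ_ j ys B ⟧) ≤ ⟦ a ⟧ * ⟦ b ⟧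
        bound (yes _) (yes _) = ≤-trans (∑-mono (tails (trace F c)) (λ ys →
            ≤-trans (ℕₚ.*-monoʳ-≤ ⟦ nth≟ _≟ₛ_ i ys A ⟧ (⟦⟧≤1 (nth≟ _≟ₛ_ j ys B)))
                  (≤-reflexive (ℕₚ.*-identityʳ _))))
          (∑-tails-nth _≟ₛ_ i (trace F c) (trace-unique F c))
        bound (no ¬a) _ = ≤-trans (∑-mono-∈ (tails (trace F c)) {g = λ _ → 0} (λ {ys} ys∈ →
            ≤-reflexive (cong (_* ⟦ nth≟ _≟ₛ_ j ys B ⟧) (absent i ¬a ys∈))))
          (≤-reflexive (∑-zero (tails (trace F c))))
        bound (yes _) (no ¬b) = ≤-trans (∑-mono-∈ (tails (trace F c)) {g = λ _ → 0} (λ {ys} ys∈ →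
            ≤-reflexive (trans (cong (⟦ nth≟ _≟ₛ_ i ys A ⟧ *_) (absent j ¬b ys∈))
                  (ℕₚ.*-zeroʳ ⟦ nth≟ _≟ₛ_ i ys A ⟧))))
          (≤-reflexive (∑-zero (tails (trace F c))))

  -- Factorial estimates

  -- With m = 4 + k + l this says that the binomial coefficient of m over 2 + k is at least that of
  -- m over 2.
  !*!≤2*! : ∀ k l → (2 + k) ! * (2 + l) ! ≤ 2 * (2 + k + l) !
  !*!≤2*! zero    l = ≤-refl
  !*!≤2*! (suc k) l = begin
    (3 + k) * (2 + k) ! * (2 + l) !       ≡⟨ ℕₚ.*-assoc (3 + k) ((2 + k) !) _ ⟩
    (3 + k) * ((2 + k) ! * (2 + l) !)     ≤⟨ ℕₚ.*-mono-≤ {3 + k} {3 + k + l} (ℕₚ.m≤m+n (3 + k) l)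
          (!*!≤2*! k l) ⟩
    (3 + k + l) * (2 * (2 + k + l) !)     ≡⟨ swap (3 + k + l) ((2 + k + l) !) ⟩
    2 * ((3 + k + l) * (2 + k + l) !) ∎
    where
    open ℕₚ.≤-Reasoning
    swap : ∀ a b → a * (2 * b) ≡ 2 * (a * b)
    swap = solve-∀

  -- The reciprocal of the binomial coefficient of m over k is 1/m for k = 1 and at most 2/(m(m-1))
  -- for 2 ≤ k ≤ m-2. The condition `2 ≤ l` keeps k away from m-1 and m, where the reciprocal is 1/m
  -- or 1 although the sets need not be adjacent.
  !*!-bound : ∀ k l {m adj} → k + l ≡ m → 1 ≤ k → 2 ≤ l → (k ≡ 1 → adj ≡ 1) →
    k ! * l ! * (m * pred m) ≤ (adj * pred m + 2) * m !
  !*!-bound 1 l {adj = adj} refl _ _ isAdj with isAdj refl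
  ... | refl = ≤-trans (≤-reflexive (regroup l (l !))) (ℕₚ.*-monoˡ-≤ (suc l * l !) {l} {1 * l + 2}
                 (≤-trans (≤-reflexive (sym (ℕₚ.*-identityˡ l))) (ℕₚ.m≤m+n (1 * l) 2)))
    where
    regroup : ∀ l f → 1 * f * (suc l * l) ≡ l * (suc l * f)
    regroup = solve-∀
  !*!-bound (suc (suc k)) (suc (suc l)) {m} {adj} e _ _ _ with trans (sym e) (e′ k l)
    where
    e′ : ∀ k l → suc (suc k) + suc (suc l) ≡ 4 + k + l
    e′ = solve-∀
  ... | refl = begin
    (2 + k) ! * (2 + l) ! * ((4 + k + l) * (3 + k + l))
      ≤⟨ ℕₚ.*-monoˡ-≤ ((4 + k + l) * (3 + k + l)) (!*!≤2*! k l) ⟩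
    2 * (2 + k + l) ! * ((4 + k + l) * (3 + k + l))
      ≡⟨ regroup (4 + k + l) (3 + k + l) ((2 + k + l) !) ⟩
    2 * (4 + k + l) !
      ≤⟨ ℕₚ.*-monoˡ-≤ ((4 + k + l) !) (ℕₚ.m≤n+m 2 (adj * (3 + k + l))) ⟩
    (adj * (3 + k + l) + 2) * (4 + k + l) ! ∎
    where
    open ℕₚ.≤-Reasoning
    regroup : ∀ a b f → 2 * f * (a * b) ≡ 2 * (a * (b * f))
    regroup = solve-∀
  !*!-bound (suc (suc k)) (suc zero) _ _ (s≤s ())

  !*!-step : ∀ r a b → r * suc a ≤ suc b → r * (suc a ! * b !) ≤ a ! * suc b !
  !*!-step r a b le = begin
    r * (suc a * a ! * b !)   ≡⟨ regroup₁ r (suc a) (a !) (b !) ⟩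
    r * suc a * (a ! * b !)   ≤⟨ ℕₚ.*-monoˡ-≤ (a ! * b !) le ⟩
    suc b * (a ! * b !)       ≡⟨ regroup₂ (suc b) (a !) (b !) ⟩
    a ! * (suc b * b !) ∎
    where
    open ℕₚ.≤-Reasoning
    regroup₁ : ∀ r c x y → r * (c * x * y) ≡ r * c * (x * y)
    regroup₁ = solve-∀
    regroup₂ : ∀ d x y → d * (x * y) ≡ x * (d * y)
    regroup₂ = solve-∀

  -- Each of the `t` steps takes a factor of at most `t + a` out of one factorial and puts a factor
  -- of at least `suc b` into the other, so the product grows at least `r`-fold.
  !*!-steps : ∀ r t a b → r * (t + a) ≤ suc b → r ^ t * ((t + a) ! * b !) ≤ a ! * (t + b) !
  !*!-steps r zero    a b le = ≤-reflexive (ℕₚ.+-identityʳ _)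
  !*!-steps r (suc t) a b le = begin
    r * r ^ t * (suc (t + a) ! * b !)    ≡⟨ regroup r (r ^ t) _ ⟩
    r ^ t * (r * (suc (t + a) ! * b !))  ≤⟨ ℕₚ.*-monoʳ-≤ (r ^ t) (!*!-step r (t + a) b le) ⟩
    r ^ t * ((t + a) ! * suc b !)        ≤⟨ !*!-steps r t a (suc b)
       (≤-trans (ℕₚ.*-monoʳ-≤ r (ℕₚ.n≤1+n (t + a))) (≤-trans le (ℕₚ.n≤1+n _))) ⟩
    a ! * (t + suc b) !                  ≡⟨ cong (λ m → a ! * m !) (ℕₚ.+-suc t b) ⟩
    a ! * (suc t + b) ! ∎
    where
    open ℕₚ.≤-Reasoning
    regroup : ∀ x y z → x * y * z ≡ y * (x * z)
    regroup = solve-∀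

  -- Rich neighbourhoods

  module _ {n : ℕ} where

    adjacentTo : Subset n → List (Subset n) → List (Subset n)
    adjacentTo A = filter (_∈? neighbours A)

    -- A set that is not a neighbour of A lies on a fraction O(n⁻²) of the chains
    -- through A, a neighbour on a fraction O(n⁻¹).
    Rich : ℕ → Subset n → List (Subset n) → Set
    Rich k A L = n ≤ k * length (adjacentTo A L) ⊎ n * n ≤ k * length L

    Central : Subset n → Set
    Central A = n ≤ 8 * ∣ A ∣ × n ≤ 8 * (n ∸ ∣ A ∣)

    -- Here `α` counts the adjacent candidates and `β` all of them. If the `α` term carries less
    -- than half of the left side, the `β` term carries at least half. The constant is 512 = 64 · 2
    -- · 4: the square of 8 from `n ≤ 8 * m`, then `m ≤ 2 * pred m`, then twice the coefficient of
    -- `β`.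
    rich-arithmetic : ∀ K m α β → 2 ≤ m → n ≤ 8 * m → m * pred m ≤ K * (α * pred m + 2 * β) →
      n ≤ 512 * K * α ⊎ n * n ≤ 512 * K * β
    rich-arithmetic K m α β 2≤m n≤8m le with m ℕₚ.≤? 2 * (K * α)
    ... | yes m≤ = inj₁ (begin
        n                    ≤⟨ n≤8m ⟩
        8 * m                ≤⟨ ℕₚ.*-monoʳ-≤ 8 m≤ ⟩
        8 * (2 * (K * α))    ≡⟨ e (K * α) ⟩
        16 * (K * α)         ≤⟨ ℕₚ.*-monoˡ-≤ (K * α) {16} {512} (ℕₚ.m≤m+n 16 496) ⟩
        512 * (K * α)        ≡⟨ sym (ℕₚ.*-assoc 512 K α) ⟩
        512 * K * α ∎)
      where
      open ℕₚ.≤-Reasoning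
      e : ∀ x → 8 * (2 * x) ≡ 16 * x
      e = solve-∀
    ... | no m≰ = inj₂ (begin
        n * n                  ≤⟨ ℕₚ.*-mono-≤ n≤8m n≤8m ⟩
        8 * m * (8 * m)        ≡⟨ e₁ m ⟩
        64 * (m * m)           ≤⟨ ℕₚ.*-monoʳ-≤ 64 (ℕₚ.*-monoʳ-≤ m m≤2[m-1]) ⟩
        64 * (m * (2 * pred m)) ≡⟨ e₂ m (pred m) ⟩
        128 * (m * pred m)     ≤⟨ ℕₚ.*-monoʳ-≤ 128 bound ⟩
        128 * (4 * (K * β))    ≡⟨ e₃ K β ⟩
        512 * K * β ∎)
      where
      open ℕₚ.≤-Reasoning
      e₁ : ∀ m → 8 * m * (8 * m) ≡ 64 * (m * m)
      e₁ = solve-∀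
      e₂ : ∀ m p → 64 * (m * (2 * p)) ≡ 128 * (m * p)
      e₂ = solve-∀
      e₃ : ∀ K β → 128 * (4 * (K * β)) ≡ 512 * K * β
      e₃ = solve-∀
      e₄ : ∀ K α p β → 2 * (K * (α * p + 2 * β)) ≡ 2 * (K * α) * p + 4 * (K * β)
      e₄ = solve-∀
      m≤2[m-1] : m ≤ 2 * pred m
      m≤2[m-1] = go 2≤m
        where
        go : ∀ {m} → 2 ≤ m → m ≤ 2 * pred m
        go {suc (suc m)} (s≤s (s≤s _)) = s≤s (≤-trans (s≤s (ℕₚ.m≤m+n m 0)) (ℕₚ.m≤n+m (suc (m + 0)) m))
      bound : m * pred m ≤ 4 * (K * β)
      bound = ℕₚ.+-cancelˡ-≤ (m * pred m) _ _ (begin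
        m * pred m + m * pred m                    ≡⟨ cong (m * pred m +_) (sym (ℕₚ.+-identityʳ _)) ⟩
        2 * (m * pred m)                           ≤⟨ ℕₚ.*-monoʳ-≤ 2 le ⟩
        2 * (K * (α * pred m + 2 * β))             ≡⟨ e₄ K α (pred m) β ⟩
        2 * (K * α) * pred m + 4 * (K * β)         ≤⟨ ℕₚ.+-monoˡ-≤ _
              (ℕₚ.*-monoˡ-≤ (pred m) (ℕₚ.<⇒≤ (ℕₚ.≰⇒> m≰))) ⟩
        m * pred m + 4 * (K * β) ∎)

    central⇒2≤ : ∀ {a} → 16 ≤ n → n ≤ 8 * a → 2 ≤ a
    central⇒2≤ {0} n≥16 le with ≤-trans n≥16 le
    ... | ()
    central⇒2≤ {1} n≥16 le with ≤-trans n≥16 le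
    ... | s≤s (s≤s (s≤s (s≤s (s≤s (s≤s (s≤s (s≤s ())))))))
    central⇒2≤ {suc (suc a)} _ _ = s≤s (s≤s z≤n)

    chainsThrough≢0 : ∀ (A : Subset n) → NonZero (chainsThrough A)
    chainsThrough≢0 A = subst NonZero (sym (chainsThrough≡ A))
      (ℕₚ.m*n≢0 (∣ A ∣ !) ((n ∸ ∣ A ∣) !) {{∣ A ∣ !≢0}} {{(n ∸ ∣ A ∣) !≢0}})

    -- Above `A`, the chains through `A` are the maximal chains of a cube of dimension `m`, and the
    -- share of them through `B` is the reciprocal of a binomial coefficient. `both-down` is the
    -- same in the cube below `A`.
    both-up : ∀ (A B : Subset n) → A ⊏ B → 2 ≤ n ∸ ∣ B ∣ →
      let m = n ∸ ∣ A ∣ in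
      chainsThroughBoth A B * (m * pred m) ≤ (⟦ B ∈? neighbours A ⟧ * pred m + 2) * chainsThrough A
    both-up A B (A⊆B , a<b) 2≤ = begin
      chainsThroughBoth A B * M                    ≤⟨ ℕₚ.*-monoˡ-≤ M (chainsThroughBoth≤ A B A⊆B) ⟩
      ∣ A ∣ ! * (∣ B ∣ ∸ ∣ A ∣) ! * (n ∸ ∣ B ∣) ! * M ≡⟨ e₁ (∣ A ∣ !) ((∣ B ∣ ∸ ∣ A ∣) !)
            ((n ∸ ∣ B ∣) !) M ⟩
      ∣ A ∣ ! * ((∣ B ∣ ∸ ∣ A ∣) ! * (n ∸ ∣ B ∣) ! * M)
        ≤⟨ ℕₚ.*-monoʳ-≤ (∣ A ∣ !) (!*!-bound (∣ B ∣ ∸ ∣ A ∣) (n ∸ ∣ B ∣) sum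
              (ℕₚ.m<n⇒0<n∸m a<b) 2≤ adjacent) ⟩
      ∣ A ∣ ! * (D * m !)                          ≡⟨ e₂ (∣ A ∣ !) D (m !) ⟩
      D * (∣ A ∣ ! * m !)                          ≡⟨ cong (D *_) (sym (chainsThrough≡ A)) ⟩
      D * chainsThrough A ∎
      where
      open ℕₚ.≤-Reasoning
      m = n ∸ ∣ A ∣
      M = m * pred m
      D = ⟦ B ∈? neighbours A ⟧ * pred m + 2
      e₁ : ∀ a b c d → a * b * c * d ≡ a * (b * c * d)
      e₁ = solve-∀
      e₂ : ∀ a b c → a * (b * c) ≡ b * (a * c)
      e₂ = solve-∀
      sum : ∣ B ∣ ∸ ∣ A ∣ + (n ∸ ∣ B ∣) ≡ m
      sum = trans (ℕₚ.+-comm (∣ B ∣ ∸ ∣ A ∣) _) (trans (sym (ℕₚ.+-∸-assoc (n ∸ ∣ B ∣) (ℕₚ.<⇒≤ a<b)))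
              (cong (_∸ ∣ A ∣) (ℕₚ.m∸n+n≡m (∣p∣≤n B))))
      adjacent : ∣ B ∣ ∸ ∣ A ∣ ≡ 1 → ⟦ B ∈? neighbours A ⟧ ≡ 1
      adjacent e = ⟦⟧-yes (B ∈? neighbours A) (proj₁ (covered⇒neighbour A B A⊆B
        (trans (sym (ℕₚ.m∸n+n≡m (ℕₚ.<⇒≤ a<b))) (cong (_+ ∣ A ∣) e))))

    both-down : ∀ (A B : Subset n) → B ⊏ A → 2 ≤ ∣ B ∣ →
      let m = ∣ A ∣ in
      chainsThroughBoth B A * (m * pred m) ≤ (⟦ B ∈? neighbours A ⟧ * pred m + 2) * chainsThrough A
    both-down A B (B⊆A , b<a) 2≤ = begin
      chainsThroughBoth B A * M                    ≤⟨ ℕₚ.*-monoˡ-≤ M (chainsThroughBoth≤ B A B⊆A) ⟩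
      ∣ B ∣ ! * (∣ A ∣ ∸ ∣ B ∣) ! * (n ∸ ∣ A ∣) ! * M ≡⟨ e₁ (∣ B ∣ !) ((∣ A ∣ ∸ ∣ B ∣) !)
            ((n ∸ ∣ A ∣) !) M ⟩
      (∣ A ∣ ∸ ∣ B ∣) ! * ∣ B ∣ ! * M * (n ∸ ∣ A ∣) !
        ≤⟨ ℕₚ.*-monoˡ-≤ ((n ∸ ∣ A ∣) !) (!*!-bound (∣ A ∣ ∸ ∣ B ∣) ∣ B ∣ (ℕₚ.m∸n+n≡m (ℕₚ.<⇒≤ b<a))
              (ℕₚ.m<n⇒0<n∸m b<a) 2≤ adjacent) ⟩
      D * ∣ A ∣ ! * (n ∸ ∣ A ∣) !                  ≡⟨ ℕₚ.*-assoc D (∣ A ∣ !) _ ⟩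
      D * (∣ A ∣ ! * (n ∸ ∣ A ∣) !)                ≡⟨ cong (D *_) (sym (chainsThrough≡ A)) ⟩
      D * chainsThrough A ∎
      where
      open ℕₚ.≤-Reasoning
      m = ∣ A ∣
      M = m * pred m
      D = ⟦ B ∈? neighbours A ⟧ * pred m + 2
      e₁ : ∀ b a c d → b * a * c * d ≡ a * b * d * c
      e₁ = solve-∀
      adjacent : ∣ A ∣ ∸ ∣ B ∣ ≡ 1 → ⟦ B ∈? neighbours A ⟧ ≡ 1
      adjacent e = ⟦⟧-yes (B ∈? neighbours A) (proj₂ (covered⇒neighbour B A B⊆A
        (trans (sym (ℕₚ.m∸n+n≡m (ℕₚ.<⇒≤ b<a))) (cong (_+ ∣ B ∣) e))))

    sum⇒rich : ∀ K m (A : Subset n) L (g : Subset n → ℕ) → 2 ≤ m → n ≤ 8 * m →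
      chainsThrough A ≤ K * ∑ L g →
      (∀ {B} → B ∈ L → g B * (m * pred m) ≤ (⟦ B ∈? neighbours A ⟧ * pred m + 2) * chainsThrough A) →
      Rich (512 * K) A L
    sum⇒rich K m A L g 2≤m n≤8m heavy light =
          rich-arithmetic K m (length (adjacentTo A L)) (length L) 2≤m n≤8m
      (ℕₚ.*-cancelʳ-≤ (m * pred m) _ (chainsThrough A) {{chainsThrough≢0 A}} (begin
        m * pred m * N                           ≡⟨ ℕₚ.*-comm (m * pred m) N ⟩
        N * (m * pred m)                         ≤⟨ ℕₚ.*-monoˡ-≤ (m * pred m) heavy ⟩
        K * ∑ L g * (m * pred m)                 ≡⟨ ℕₚ.*-assoc K (∑ L g) _ ⟩
        K * (∑ L g * (m * pred m))               ≡⟨ cong (K *_) (sym (∑-*ʳ L (m * pred m) g)) ⟩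
        K * ∑ L (λ B → g B * (m * pred m))       ≤⟨ ℕₚ.*-monoʳ-≤ K (∑-mono-∈ L light) ⟩
        K * ∑ L (λ B → (⟦ B ∈? neighbours A ⟧ * pred m + 2) * N)
          ≡⟨ cong (K *_) (trans (∑-*ʳ L N _) (cong (_* N) (trans (∑-distrib-+ L _ (λ _ → 2))
               (cong₂ _+_ (trans (∑-*ʳ L (pred m) _) (cong (_* pred m)
                     (sym (length-filter-∑ (_∈? neighbours A) L))))
                          (trans (∑-const L 2) (ℕₚ.*-comm (length L) 2)))))) ⟩
        K * ((length (adjacentTo A L) * pred m + 2 * length L) * N)  ≡⟨ sym (ℕₚ.*-assoc K _ N) ⟩
        K * (length (adjacentTo A L) * pred m + 2 * length L) * N ∎))
      where
      open ℕₚ.≤-Reasoning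
      N = chainsThrough A

  -- Branching sets from surviving windows

  Comparable : ∀ {n} → ℕ → ℕ → Subset n → Subset n → Set
  Comparable i j A B = (i < j → A ⊆ B) × (j < i → B ⊆ A)

  module _ {n : ℕ} (F : List (Subset n)) (h k : ℕ) where

    -- A can serve at position i as the root of every tree of radius r.
    Branches : ℕ → ℕ → Subset n → Set
    Branches zero    i A = A ∈ F
    Branches (suc r) i A = A ∈ F × (∀ j → j ≤ h → i ≢ j → ∃[ L ] Unique L × Rich k A L ×
      (∀ {B} → B ∈ L → A ≢ B × Comparable i j A B × Branches r j B))

    Branches⇒∈ : ∀ r {i A} → Branches r i A → A ∈ F
    Branches⇒∈ zero    A∈F       = A∈F
    Branches⇒∈ (suc r) (A∈F , _) = A∈F

  module Survival {n : ℕ} (F : List (Subset n)) (F-unique : Unique F) (h K : ℕ) where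

    tests : List (ℕ × Subset n)
    tests = cartesianProduct (upTo (suc h)) F

    open Cleaning _At?_ tests (chainsThrough ∘ proj₂) K

    surviving : ℕ → List (Window n)
    surviving zero    = allWindows F h
    surviving (suc r) = clean (surviving r)

    surviving⊆ : ∀ r {w} → w ∈ surviving r → w ∈ allWindows F h
    surviving⊆ zero    w∈ = w∈
    surviving⊆ (suc r) w∈ = surviving⊆ r (proj₁ (∈-filter⁻
          (λ w → All.all? (passes? (surviving r) w) tests) {xs = surviving r} w∈))

    ∑-surviving≤ : ∀ r f → ∑ (surviving r) f ≤ ∑ (allWindows F h) f
    ∑-surviving≤ zero    f = ≤-refl
    ∑-surviving≤ (suc r) f = ≤-trans (∑-filter-≤ (λ w → All.all? (passes? (surviving r) w) tests)
          (surviving r) f) (∑-surviving≤ r f)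

    ∑-tests : ∑ tests (chainsThrough ∘ proj₂) ≡ suc h * ∑ F chainsThrough
    ∑-tests = trans (∑-cartesianProductWith _,_ (upTo (suc h)) F _)
      (trans (∑-const (upTo (suc h)) (∑ F chainsThrough))
            (cong (_* ∑ F chainsThrough) (length-upTo (suc h))))

    length≤surviving : ∀ r →
      K * length (allWindows F h) ≤ K * length (surviving r) + r * (suc h * ∑ F chainsThrough)
    length≤surviving zero    = ℕₚ.m≤m+n _ 0
    length≤surviving (suc r) = ≤-trans (length≤surviving r) (≤-trans
      (ℕₚ.+-monoˡ-≤ _ (≤-trans (length≤clean (surviving r))
            (≤-reflexive (cong (K * length (surviving (suc r)) +_) ∑-tests))))
      (≤-reflexive (ℕₚ.+-assoc (K * length (surviving (suc r))) _ _)))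

    module _ (central : ∀ {A} → A ∈ F → Central A) (16≤n : 16 ≤ n) where

      -- A window left after round r + 1 certifies that `A` is at position `i` in many windows left
      -- after round r. Each of these has an entry at position `j`, and by induction that entry
      -- branches to radius r; the entries so obtained are the candidates.
      branches : ∀ r {i A w} → w ∈ surviving r → i ≤ h → (i , A) At w → Branches F h (512 * K) r i A
      branches zero    w∈ i≤h at = proj₁ (At-∈ F h w∈ at)
      branches (suc r) {i} {A} {w} w∈ i≤h at = A∈F , λ j j≤h i≢j →
          nearby j , Uniqueₚ.filter⁺ (witness? j) F-unique , rich j j≤h i≢j , λ B∈ →
            let B∈F , wit = ∈-filter⁻ (witness? j) {xs = F} B∈
                w′ , w′∈ , Aw′ , Bw′ = find wit
                w′∈₀ = surviving⊆ r w′∈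
            in distinct w′∈₀ i≢j Aw′ Bw′
             , ((λ i<j → proj₁ (At-⊏ F h w′∈₀ i<j Aw′ Bw′)) , (λ j<i → proj₁ (At-⊏ F h w′∈₀ j<i Bw′ Aw′)))
             , branches r w′∈ j≤h Bw′
        where
        M = surviving r
        split = ∈-filter⁻ (λ w → All.all? (passes? M w) tests) {xs = M} w∈
        A∈F = proj₁ (At-∈ F h {w = w} (surviving⊆ r (proj₁ split)) at)
        heavy : chainsThrough A ≤ K * degree M (i , A)
        heavy = All.lookup (proj₂ split) (∈-cartesianProduct⁺ (∈-upTo⁺ (s≤s i≤h)) A∈F) at

        distinct : ∀ {j B w} → w ∈ allWindows F h → i ≢ j → (i , A) At w → (j , B) At w → A ≢ B
        distinct {j} w∈ i≢j Aw Bw with ℕₚ.<-cmp i j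
        ... | tri< i<j _ _ = ⊏⇒≢ (At-⊏ F h w∈ i<j Aw Bw)
        ... | tri≈ _ i≡j _ = contradiction i≡j i≢j
        ... | tri> _ _ j<i = ⊏⇒≢ (At-⊏ F h w∈ j<i Bw Aw) ∘ sym

        witness? : ∀ j B → Dec (Any (λ w → (i , A) At w × (j , B) At w) M)
        witness? j B = any? (λ w → ((i , A) At? w) ×-dec ((j , B) At? w)) M

        nearby : ℕ → List (Subset n)
        nearby j = filter (witness? j) F

        -- Every window has an entry at position `j`, so the windows with `A` at `i` are all counted
        -- when they are sorted by that entry.
        spread : ∀ j → j ≤ h →
          degree M (i , A) ≤ ∑ (nearby j) (λ B → ∑ M (λ w → ⟦ (i , A) At? w ⟧ * ⟦ (j , B) At? w ⟧))
        spread j j≤h = ≤-trans (∑-mono-∈ M single) (≤-reflexive (sym (∑-swap (nearby j) M _)))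
          where
          single : ∀ {w} → w ∈ M → ⟦ (i , A) At? w ⟧ ≤ ∑ (nearby j) (λ B →
                ⟦ (i , A) At? w ⟧ * ⟦ (j , B) At? w ⟧)
          single {w} w∈ with (i , A) At? w
          ... | no _ = z≤n
          ... | yes Aw with At-defined F h {w = w} (surviving⊆ r w∈) j≤h
          ...   | B , Bw = ≤-trans (≤-reflexive (sym (trans (ℕₚ.+-identityʳ _)
                (⟦⟧-yes ((j , B) At? w) Bw))))
            (∑-single (nearby j) (λ B → 1 * ⟦ (j , B) At? w ⟧)
              (∈-filter⁺ (witness? j) (proj₁ (At-∈ F h {w = w} (surviving⊆ r w∈) Bw)) (lose w∈ (Aw , Bw))))

        rich : ∀ j → j ≤ h → i ≢ j → Rich (512 * K) A (nearby j)
        rich j j≤h i≢j with ℕₚ.<-cmp i j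
        ... | tri≈ _ i≡j _ = contradiction i≡j i≢j
        ... | tri< i<j _ _ = sum⇒rich K (n ∸ ∣ A ∣) A (nearby j) (chainsThroughBoth A)
            (central⇒2≤ 16≤n (proj₂ (central A∈F))) (proj₂ (central A∈F))
            (≤-trans heavy (ℕₚ.*-monoʳ-≤ K (≤-trans (spread j j≤h) (∑-mono (nearby j) λ B →
               ≤-trans (∑-surviving≤ r _) (∑-At-pair F h i j A B)))))
            λ {B} B∈ → let B∈F , wit = ∈-filter⁻ (witness? j) {xs = F} B∈
                           w′ , w′∈ , Aw′ , Bw′ = find wit
                       in both-up A B (At-⊏ F h (surviving⊆ r w′∈) i<j Aw′ Bw′)
                             (central⇒2≤ 16≤n (proj₂ (central B∈F)))
        ... | tri> _ _ j<i = sum⇒rich K ∣ A ∣ A (nearby j) (λ B → chainsThroughBoth B A)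
            (central⇒2≤ 16≤n (proj₁ (central A∈F))) (proj₁ (central A∈F))
            (≤-trans heavy (ℕₚ.*-monoʳ-≤ K (≤-trans (spread j j≤h) (∑-mono (nearby j) λ B →
               ≤-trans (∑-surviving≤ r _) (≤-trans (≤-reflexive
                     (∑-cong (allWindows F h) λ w → ℕₚ.*-comm ⟦ (i , A) At? w ⟧ _))
                 (∑-At-pair F h j i B A))))))
            λ {B} B∈ → let B∈F , wit = ∈-filter⁻ (witness? j) {xs = F} B∈
                           w′ , w′∈ , Aw′ , Bw′ = find wit
                       in both-down A B (At-⊏ F h (surviving⊆ r w′∈) j<i Bw′ Aw′)
                             (central⇒2≤ 16≤n (proj₁ (central B∈F)))

  -- Families of large density

  middle : ℕ → ℕ
  middle n = ⌊ n /2⌋ ! * (n ∸ ⌊ n /2⌋) !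

  halves : ∀ n → n ∸ ⌊ n /2⌋ ≡ ⌈ n /2⌉
  halves n = trans (cong (_∸ ⌊ n /2⌋) (sym (ℕₚ.⌊n/2⌋+⌈n/2⌉≡n n))) (ℕₚ.m+n∸m≡n ⌊ n /2⌋ ⌈ n /2⌉)

  C*middle≡! : ∀ n → (n C ⌊ n /2⌋) * middle n ≡ n !
  C*middle≡! n = trans (cong (_* middle n) (nCk≡n!/k![n-k]! half≤))
    (m/n*n≡m {{ℕₚ.m*n≢0 _ _ {{⌊ n /2⌋ !≢0}} {{(n ∸ ⌊ n /2⌋) !≢0}}}} (k![n∸k]!∣n! half≤))
    where
    half≤ : ⌊ n /2⌋ ≤ n
    half≤ = ℕₚ.⌊n/2⌋≤n n

  middle≢0 : ∀ n → NonZero (middle n)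
  middle≢0 n = ℕₚ.m*n≢0 _ _ {{⌊ n /2⌋ !≢0}} {{(n ∸ ⌊ n /2⌋) !≢0}}

  !*!-shift : ∀ x s y s′ → x + y ≡ s + s′ → x ≤ s → s ≤ suc s′ → s ! * s′ ! ≤ x ! * y !
  !*!-shift x s y s′ e x≤s s≤ = begin
    s ! * s′ !                              ≡⟨ cong (λ m → m ! * s′ !) (sym (ℕₚ.m∸n+n≡m x≤s)) ⟩
    (t + x) ! * s′ !                        ≡⟨ sym (trans (cong (_* ((t + x) ! * s′ !)) (ℕₚ.^-zeroˡ t))
          (ℕₚ.*-identityˡ _)) ⟩
    1 ^ t * ((t + x) ! * s′ !)              ≤⟨ !*!-steps 1 t x s′
          (≤-trans (≤-reflexive (trans (ℕₚ.*-identityˡ _) (ℕₚ.m∸n+n≡m x≤s))) s≤) ⟩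
    x ! * (t + s′) !                        ≡⟨ cong (λ m → x ! * m !) t+s′ ⟩
    x ! * y ! ∎
    where
    open ℕₚ.≤-Reasoning
    t = s ∸ x
    t+s′ : t + s′ ≡ y
    t+s′ = ℕₚ.+-cancelˡ-≡ x _ _ (trans (sym (ℕₚ.+-assoc x t s′))
      (trans (cong (_+ s′) (ℕₚ.m+[n∸m]≡n x≤s)) (sym e)))

  -- The central binomial coefficient is the largest: moving factors one at a time away from the
  -- balanced split never decreases the product.
  middle≤!*! : ∀ n x y → x + y ≡ n → middle n ≤ x ! * y !
  middle≤!*! n x y e with ℕₚ.≤-total x ⌊ n /2⌋
  ... | inj₁ x≤ = subst (λ m → ⌊ n /2⌋ ! * m ! ≤ x ! * y !) (sym (halves n))
    (!*!-shift x ⌊ n /2⌋ y ⌈ n /2⌉ (trans e (sym (ℕₚ.⌊n/2⌋+⌈n/2⌉≡n n))) x≤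
          (ℕₚ.m≤n⇒m≤1+n (ℕₚ.⌊n/2⌋≤⌈n/2⌉ n)))
  ... | inj₂ ≤x = subst₂ _≤_ (trans (ℕₚ.*-comm (⌈ n /2⌉ !) _)
        (cong (λ m → ⌊ n /2⌋ ! * m !) (sym (halves n)))) (ℕₚ.*-comm (y !) (x !))
    (!*!-shift y ⌈ n /2⌉ x ⌊ n /2⌋ sum y≤ (⌈⌉≤suc⌊⌋ n))
    where
    ⌈⌉≤suc⌊⌋ : ∀ n → ⌈ n /2⌉ ≤ suc ⌊ n /2⌋
    ⌈⌉≤suc⌊⌋ n = ℕₚ.⌊n/2⌋-mono (ℕₚ.n≤1+n (suc n))
    sum : y + x ≡ ⌈ n /2⌉ + ⌊ n /2⌋
    sum = trans (ℕₚ.+-comm y x) (trans e (trans (sym (ℕₚ.⌊n/2⌋+⌈n/2⌉≡n n)) (ℕₚ.+-comm ⌊ n /2⌋ _)))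
    y≤ : y ≤ ⌈ n /2⌉
    y≤ = ℕₚ.+-cancelˡ-≤ ⌊ n /2⌋ _ _ (≤-trans (ℕₚ.+-monoˡ-≤ y ≤x)
          (≤-reflexive (trans e (sym (ℕₚ.⌊n/2⌋+⌈n/2⌉≡n n)))))

  -- The `m` steps from `a` to `m + a` stay within n/4. There the other part is still at least three
  -- times as large, so each step gains a factor 2; the rest is compared with the middle.
  outer-!*! : ∀ n a b m → a + b ≡ n → 8 * a ≤ n → 8 * m ≤ n → 2 ^ m * middle n ≤ a ! * b !
  outer-!*! n a b m e 8a≤n 8m≤n = begin
    2 ^ m * middle n             ≤⟨ ℕₚ.*-monoʳ-≤ (2 ^ m) (middle≤!*! n (m + a) b′ split) ⟩
    2 ^ m * ((m + a) ! * b′ !)   ≤⟨ !*!-steps 2 m a b′ (ℕₚ.m≤n⇒m≤1+n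
          (≤-trans (ℕₚ.*-monoˡ-≤ (m + a) {2} {3} (s≤s (s≤s z≤n))) triple)) ⟩
    a ! * (m + b′) !             ≡⟨ cong (λ k → a ! * k !)
          (ℕₚ.+-cancelˡ-≡ a _ _ (trans (regroup a m b′) (trans split (sym e)))) ⟩
    a ! * b ! ∎
    where
    open ℕₚ.≤-Reasoning
    b′ = n ∸ (m + a)
    regroup : ∀ a m b → a + (m + b) ≡ m + a + b
    regroup = solve-∀
    quad : 4 * (m + a) ≤ n
    quad = ℕₚ.*-cancelˡ-≤ 2 (begin
      2 * (4 * (m + a))  ≡⟨ e₁ m a ⟩
      8 * m + 8 * a      ≤⟨ +-mono-≤ 8m≤n 8a≤n ⟩
      n + n              ≡⟨ cong (n +_) (sym (ℕₚ.+-identityʳ n)) ⟩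
      2 * n ∎)
      where
      e₁ : ∀ m a → 2 * (4 * (m + a)) ≡ 8 * m + 8 * a
      e₁ = solve-∀
    split : m + a + b′ ≡ n
    split = ℕₚ.m+[n∸m]≡n (≤-trans (ℕₚ.m≤m+n (m + a) _) quad)
    triple : 3 * (m + a) ≤ b′
    triple = ℕₚ.+-cancelˡ-≤ (m + a) _ _ (≤-trans quad (≤-reflexive (sym split)))

  middle≤chainsThrough : ∀ {n} (A : Subset n) → middle n ≤ chainsThrough A
  middle≤chainsThrough {n} A = ≤-trans (middle≤!*! n ∣ A ∣ (n ∸ ∣ A ∣) (ℕₚ.m+[n∸m]≡n (∣p∣≤n A)))
    (≤-reflexive (sym (chainsThrough≡ A)))

  central? : ∀ {n} (A : Subset n) → Dec (Central A)
  central? {n} A = (n ℕₚ.≤? 8 * ∣ A ∣) ×-dec (n ℕₚ.≤? 8 * (n ∸ ∣ A ∣))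

  outer-chainsThrough : ∀ {n} (A : Subset n) → ¬ Central A → 2 ^ (n / 8) * middle n ≤ chainsThrough A
  outer-chainsThrough {n} A ¬c = ≤-trans bound (≤-reflexive (sym (chainsThrough≡ A)))
    where
    sum = ℕₚ.m+[n∸m]≡n (∣p∣≤n A)
    8m≤n : 8 * (n / 8) ≤ n
    8m≤n = ≤-trans (≤-reflexive (ℕₚ.*-comm 8 (n / 8))) (m/n*n≤m n 8)
    bound : 2 ^ (n / 8) * middle n ≤ ∣ A ∣ ! * (n ∸ ∣ A ∣) !
    bound with n ℕₚ.≤? 8 * ∣ A ∣ | n ℕₚ.≤? 8 * (n ∸ ∣ A ∣)
    ... | yes p | yes q = contradiction (p , q) ¬c
    ... | no ¬p | _     = outer-!*! n ∣ A ∣ (n ∸ ∣ A ∣) (n / 8) sum (ℕₚ.<⇒≤ (ℕₚ.≰⇒> ¬p)) 8m≤n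
    ... | yes _ | no ¬q = ≤-trans (outer-!*! n (n ∸ ∣ A ∣) ∣ A ∣ (n / 8)
          (trans (ℕₚ.+-comm (n ∸ ∣ A ∣) ∣ A ∣) sum) (ℕₚ.<⇒≤ (ℕₚ.≰⇒> ¬q)) 8m≤n)
                                  (≤-reflexive (ℕₚ.*-comm ((n ∸ ∣ A ∣) !) _))

  square≤4*2^ : ∀ m → suc m * suc m ≤ 4 * 2 ^ m
  square≤4*2^ 0 = s≤s z≤n
  square≤4*2^ 1 = ℕₚ.m≤m+n 4 4
  square≤4*2^ 2 = ℕₚ.m≤m+n 9 7
  square≤4*2^ (suc (suc (suc m))) = begin
    (4 + m) * (4 + m)                       ≤⟨ ℕₚ.m≤m+n _ (2 + 4 * m + m * m) ⟩
    (4 + m) * (4 + m) + (2 + 4 * m + m * m) ≡⟨ e₁ m ⟩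
    2 * ((3 + m) * (3 + m))                 ≤⟨ ℕₚ.*-monoʳ-≤ 2 (square≤4*2^ (suc (suc m))) ⟩
    2 * (4 * 2 ^ (2 + m))                   ≡⟨ e₂ (2 ^ (2 + m)) ⟩
    4 * 2 ^ (3 + m) ∎
    where
    open ℕₚ.≤-Reasoning
    e₁ : ∀ m → (4 + m) * (4 + m) + (2 + 4 * m + m * m) ≡ 2 * ((3 + m) * (3 + m))
    e₁ = solve-∀
    e₂ : ∀ x → 2 * (4 * x) ≡ 4 * (2 * x)
    e₂ = solve-∀

  -- With m = n / 8 one has n + 1 ≤ 8(m + 1), and (m + 1)² ≤ 4 · 2^m reduces the claim to 64 q ≤ m +
  -- 1. Hence 512 = 8 · 64.
  exponential-dominates : ∀ q n → 512 * q ≤ n → 2 * q * suc n ≤ 2 ^ (n / 8)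
  exponential-dominates q n large = begin
    2 * q * suc n           ≤⟨ ℕₚ.*-monoʳ-≤ (2 * q) n<8[m+1] ⟩
    2 * q * (8 * suc m)     ≡⟨ e₁ q (suc m) ⟩
    16 * q * suc m          ≤⟨ ℕₚ.*-cancelˡ-≤ 4 (begin
        4 * (16 * q * suc m)  ≡⟨ e₂ q (suc m) ⟩
        64 * q * suc m        ≤⟨ ℕₚ.*-monoˡ-≤ (suc m) 64q≤ ⟩
        suc m * suc m         ≤⟨ square≤4*2^ m ⟩
        4 * 2 ^ m ∎) ⟩
    2 ^ m ∎
    where
    open ℕₚ.≤-Reasoning
    m = n / 8
    e₁ : ∀ q x → 2 * q * (8 * x) ≡ 16 * q * x
    e₁ = solve-∀
    e₂ : ∀ q x → 4 * (16 * q * x) ≡ 64 * q * x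
    e₂ = solve-∀
    e₃ : ∀ q → 8 * (64 * q) ≡ 512 * q
    e₃ = solve-∀
    n<8[m+1] : n < 8 * suc m
    n<8[m+1] = begin-strict
      n                ≡⟨ m≡m%n+[m/n]*n n 8 ⟩
      n % 8 + m * 8    <⟨ ℕₚ.+-monoˡ-< (m * 8) (m%n<n n 8) ⟩
      8 + m * 8        ≡⟨ ℕₚ.*-comm (suc m) 8 ⟩
      8 * suc m ∎
    64q≤ : 64 * q ≤ suc m
    64q≤ = ℕₚ.*-cancelˡ-≤ 8 (≤-trans (≤-reflexive (e₃ q)) (≤-trans large (ℕₚ.<⇒≤ n<8[m+1])))

  length-filter-complement : ∀ {X : Set} {P : X → Set} (P? : ∀ x → Dec (P x)) xs →
    length (filter P? xs) + length (filter (¬? ∘ P?) xs) ≡ length xs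
  length-filter-complement P? [] = refl
  length-filter-complement P? (x ∷ xs) with P? x
  ... | yes _ = cong suc (length-filter-complement P? xs)
  ... | no  _ = trans (ℕₚ.+-suc _ _) (cong suc (length-filter-complement P? xs))

  length-chain-weight : ∀ {n} (L : List (Subset n)) w → (∀ {A} → A ∈ L → w ≤ chainsThrough A) →
    length L * w ≤ ∑ L chainsThrough
  length-chain-weight L w le = ≤-trans (≤-reflexive (sym (∑-const L w))) (∑-mono-∈ L le)

  -- Double counting: a chain meets at most n + 1 sets, while a non-central set lies on at least
  -- 2^(n / 8) times as many chains as a set of middle size.
  outer-few : ∀ {n} q (T : List (Subset n)) → Unique T → 512 * q ≤ n →
    (∀ {A} → A ∈ T → ¬ Central A) → 2 * q * length T ≤ n C ⌊ n /2⌋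
  outer-few {n} q T u large outer =
        ℕₚ.*-cancelˡ-≤ (suc n) (ℕₚ.*-cancelʳ-≤ _ _ (middle n) {{middle≢0 n}} (begin
    suc n * (2 * q * t) * middle n        ≡⟨ e₁ (suc n) q t (middle n) ⟩
    2 * q * suc n * (t * middle n)        ≤⟨ ℕₚ.*-monoˡ-≤ _ (exponential-dominates q n large) ⟩
    2 ^ (n / 8) * (t * middle n)          ≡⟨ e₂ (2 ^ (n / 8)) t (middle n) ⟩
    t * (2 ^ (n / 8) * middle n)          ≤⟨ length-chain-weight T _
          (λ {A} A∈ → outer-chainsThrough A (outer A∈)) ⟩
    ∑ T chainsThrough                     ≤⟨ ∑-chainsThrough≤∑-trace T u ⟩
    ∑ (chains n) (λ c → length (trace T c)) ≤⟨ ∑-mono (chains n) (length-trace T) ⟩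
    ∑ (chains n) (λ _ → suc n)            ≡⟨ ∑-const (chains n) (suc n) ⟩
    length (chains n) * suc n             ≡⟨ trans (ℕₚ.*-comm (length (chains n)) _)
          (cong (suc n *_) (trans (length-chains n) (sym (C*middle≡! n)))) ⟩
    suc n * ((n C ⌊ n /2⌋) * middle n)    ≡⟨ sym (ℕₚ.*-assoc (suc n) (n C ⌊ n /2⌋) (middle n)) ⟩
    suc n * (n C ⌊ n /2⌋) * middle n ∎))
    where
    open ℕₚ.≤-Reasoning
    t = length T
    e₁ : ∀ s q t m → s * (2 * q * t) * m ≡ 2 * q * s * (t * m)
    e₁ = solve-∀
    e₂ : ∀ s t m → s * (t * m) ≡ t * (s * m)
    e₂ = solve-∀

  -- Let S be the number of incidences between sets and chains, T = n!, W the number of windows and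
  -- Q = q h + 1. From S ≤ h T + W and Q T ≤ q S follows S ≤ Q W. If no window were left, K W ≤ r (h
  -- + 1) S would hold; `K` is the least integer above r (h + 1) Q, which excludes this because S >
  -- 0.
  windows-survive : ∀ {n} q h (F : List (Subset n)) (u : Unique F) r →
    (q * h + 1) * (n C ⌊ n /2⌋) ≤ q * length F →
    let K = r * suc h * (q * h + 1) + 1 in
    ∃[ w ] w ∈ Survival.surviving F u h K r
  windows-survive {n} q h F u r big with Survival.surviving F u h (r * suc h * (q * h + 1) + 1) r in eq
  ... | w ∷ _ = w , here refl
  ... | []    = contradiction tooSmall (ℕₚ.<⇒≱ tooLarge)
    where
    open ℕₚ.≤-Reasoning
    K = r * suc h * (q * h + 1) + 1
    S = ∑ F chainsThrough
    T = n !
    Q = q * h + 1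
    W = length (allWindows F h)
    open Survival F u h K
    density : Q * T ≤ q * S
    density = begin
      Q * T                                   ≡⟨ cong (Q *_) (sym (C*middle≡! n)) ⟩
      Q * ((n C ⌊ n /2⌋) * middle n)          ≡⟨ sym (ℕₚ.*-assoc Q _ _) ⟩
      Q * (n C ⌊ n /2⌋) * middle n            ≤⟨ ℕₚ.*-monoˡ-≤ (middle n) big ⟩
      q * length F * middle n                 ≡⟨ ℕₚ.*-assoc q _ _ ⟩
      q * (length F * middle n)               ≤⟨ ℕₚ.*-monoʳ-≤ q
            (length-chain-weight F _ (λ {A} _ → middle≤chainsThrough A)) ⟩
      q * S ∎
    S≤ : S ≤ h * T + W
    S≤ = ≤-trans (∑-chainsThrough≤∑-trace F u) (≤-trans (∑-trace≤allWindows F h)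
           (≤-reflexive (cong (λ t → h * t + W) (length-chains n))))
    KW≤ : K * W ≤ r * (suc h * S)
    KW≤ = ≤-trans (length≤surviving r) (≤-reflexive (trans
            (cong (λ M → K * length M + r * (suc h * S)) eq) (cong (_+ r * (suc h * S)) (ℕₚ.*-zeroʳ K))))
    0<T : 0 < T
    0<T = >-nonZero⁻¹ T {{n !≢0}}
    0<S : 0 < S
    0<S = ℕₚ.n≢0⇒n>0 λ S≡0 → ℕₚ.<⇒≱ 0<T (ℕₚ.≤-trans (ℕₚ.m≤n*m T Q {{Q≢0}})
          (≤-trans density (≤-reflexive (trans (cong (q *_) S≡0) (ℕₚ.*-zeroʳ q)))))
      where
      Q≢0 : NonZero Q
      Q≢0 = >-nonZero (ℕₚ.m≤n+m 1 (q * h))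
    e₁ : ∀ Q K h T W → Q * (K * (h * T + W)) ≡ K * h * (Q * T) + Q * (K * W)
    e₁ = solve-∀
    e₂ : ∀ K h q S r → K * h * (q * S) + (q * h + 1) * (r * (suc h * S)) ≡ q * h * K * S + r * suc h *
          (q * h + 1) * S
    e₂ = solve-∀
    e₃ : ∀ q h K S → (q * h + 1) * (K * S) ≡ q * h * K * S + K * S
    e₃ = solve-∀
    tooSmall : K * S ≤ r * suc h * (q * h + 1) * S
    tooSmall = ℕₚ.+-cancelˡ-≤ (q * h * K * S) _ _ (begin
      q * h * K * S + K * S                      ≡⟨ sym (e₃ q h K S) ⟩
      Q * (K * S)                                ≤⟨ ℕₚ.*-monoʳ-≤ Q (ℕₚ.*-monoʳ-≤ K S≤) ⟩
      Q * (K * (h * T + W))                      ≡⟨ e₁ Q K h T W ⟩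
      K * h * (Q * T) + Q * (K * W)              ≤⟨ +-mono-≤ (ℕₚ.*-monoʳ-≤ (K * h) density)
            (ℕₚ.*-monoʳ-≤ Q KW≤) ⟩
      K * h * (q * S) + Q * (r * (suc h * S))    ≡⟨ e₂ K h q S r ⟩
      q * h * K * S + r * suc h * (q * h + 1) * S ∎)
    tooLarge : r * suc h * (q * h + 1) * S < K * S
    tooLarge = ℕₚ.*-monoˡ-< S {{>-nonZero 0<S}} (≤-reflexive (sym (ℕₚ.+-comm (r * suc h * (q * h + 1)) 1)))

  -- The value of `K` in `windows-survive` with `2 * q` for `q`: half of the excess density 1/q is
  -- spent on removing the non-central sets.
  branchingConstant : ℕ → ℕ → ℕ → ℕ
  branchingConstant q h r = r * suc h * (2 * q * h + 1) + 1

  dense⇒branches′ : ∀ {n} q h r (F : List (Subset n)) → Unique F → 1 ≤ q → 512 * q ≤ n →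
    (q * h + 1) * (n C ⌊ n /2⌋) ≤ q * length F →
    ∃[ F′ ] (∀ {A} → A ∈ F′ → A ∈ F) ×
      (∀ i → i ≤ h → ∃[ A ] Branches F′ h (512 * branchingConstant q h r) r i A)
  dense⇒branches′ {n} q h r F u 1≤q large big = F′ , (λ A∈ → proj₁ (∈-filter⁻ central? {xs =
        F} A∈)) , λ i i≤h →
      let w , w∈ = windows-survive (2 * q) h F′ u′ r big′
          A , at = At-defined F′ h {w = w} (surviving⊆ r w∈) i≤h
      in A , branches (λ A∈ → proj₂ (∈-filter⁻ central? {xs = F} A∈)) 16≤n r w∈ i≤h at
    where
    open ℕₚ.≤-Reasoning
    F′ = filter central? F
    T = filter (¬? ∘ central?) F
    u′ = Uniqueₚ.filter⁺ central? u
    c = n C ⌊ n /2⌋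
    open Survival F′ u′ h (branchingConstant q h r)
    16≤n : 16 ≤ n
    16≤n = ≤-trans (ℕₚ.m≤m+n 16 496) (≤-trans (ℕₚ.*-monoʳ-≤ 512 1≤q) large)
    few : 2 * q * length T ≤ c
    few = outer-few q T (Uniqueₚ.filter⁺ (¬? ∘ central?) u) large
          (λ A∈ → proj₂ (∈-filter⁻ (¬? ∘ central?) {xs = F} A∈))
    e₁ : ∀ q h c → (2 * q * h + 1) * c + c ≡ 2 * ((q * h + 1) * c)
    e₁ = solve-∀
    big′ : (2 * q * h + 1) * c ≤ 2 * q * length F′
    big′ = ℕₚ.+-cancelʳ-≤ c _ _ (begin
      (2 * q * h + 1) * c + c                   ≡⟨ e₁ q h c ⟩
      2 * ((q * h + 1) * c)                     ≤⟨ ℕₚ.*-monoʳ-≤ 2 big ⟩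
      2 * (q * length F)                        ≡⟨ sym (ℕₚ.*-assoc 2 q _) ⟩
      2 * q * length F                          ≡⟨ cong (2 * q *_)
            (sym (length-filter-complement central? F)) ⟩
      2 * q * (length F′ + length T)            ≡⟨ ℕₚ.*-distribˡ-+ (2 * q) _ _ ⟩
      2 * q * length F′ + 2 * q * length T      ≤⟨ ℕₚ.+-monoʳ-≤ (2 * q * length F′) few ⟩
      2 * q * length F′ + c ∎)

  abstract
    dense⇒branches : ∀ q h r → 1 ≤ q → ∃[ k ] NonZero k × (∃[ N ] (∀ {n} (F : List (Subset n)) →
          Unique F → N ≤ n →
      (q * h + 1) * (n C ⌊ n /2⌋) ≤ q * length F →
      ∃[ F′ ] (∀ {A} → A ∈ F′ → A ∈ F) × (∀ i → i ≤ h → ∃[ A ] Branches F′ h k r i A)))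
    dense⇒branches q h r 1≤q = 512 * branchingConstant q h r
      , ℕₚ.m*n≢0 512 (branchingConstant q h r) {{_}} {{>-nonZero
            (ℕₚ.m≤n+m 1 (r * suc h * (2 * q * h + 1)))}}
      , 512 * q
      , λ F u large → dense⇒branches′ q h r F u 1≤q large

  -- Embedding the blow-up

  module Rank (P : FinPoset) where
    open FinPoset P

    -- A descending sequence as a nested existential is decidable by recursion on its length, so
    -- that `least` can find the first length that is not attained.
    Descent : ℕ → Carrier → Set
    Descent zero    u = ⊤
    Descent (suc k) u = ∃[ v ] v ≺ u × Descent k v

    descent? : ∀ k u → Dec (Descent k u)
    descent? zero    u = yes tt
    descent? (suc k) u = anyᶠ? (λ v → (v ≺? u) ×-dec descent? k v)

    descent-≤ : ∀ {k l} → k ≤ l → ∀ {u} → Descent l u → Descent k u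
    descent-≤ z≤n     d            = tt
    descent-≤ (s≤s p) (v , lt , d) = v , lt , descent-≤ p d

    descent⇒chain : ∀ k {u} → Descent k u → ∃[ xs ] IsChain (u ∷ xs) × All (_≺ u) xs × length xs ≡ k
    descent⇒chain zero    _            = [] , ([] ∷ []) , [] , refl
    descent⇒chain (suc k) (v , lt , d) with descent⇒chain k d
    ... | xs , chain , below , len = v ∷ xs , (All.map inj₂ belowU ∷ chain) , belowU , cong suc len
      where
      belowU = lt ∷ All.map (λ w≺v → PosetProperties.<-trans poset w≺v lt) below

    module _ {h} (bound : ∀ xs → IsChain xs → length xs ≤ suc h) where

      private
        ¬descent : ∀ u → ¬ Descent (suc h) u
        ¬descent u d with descent⇒chain (suc h) d
        ... | xs , chain , _ , len =
              ℕₚ.<-irrefl refl (≤-trans (s≤s (≤-reflexive (sym len))) (bound (u ∷ xs) chain))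

        leastMissing : ∀ u → ∃ (IsLeast (λ k → ¬ Descent (suc k) u))
        leastMissing u = least (λ k → ¬? (descent? (suc k) u)) (h , ¬descent u)

      rank : Carrier → ℕ
      rank u = proj₁ (leastMissing u)

      rank≤ : ∀ u → rank u ≤ h
      rank≤ u = proj₂ (proj₂ (leastMissing u)) h (¬descent u)

      descent-rank : ∀ u → Descent (rank u) u
      descent-rank u with rank u | proj₂ (proj₂ (leastMissing u))
      ... | zero  | _   = tt
      ... | suc k | min = decidable-stable (descent? (suc k) u) (λ ¬d → ℕₚ.<⇒≱ ≤-refl (min k ¬d))

      rank-mono : ∀ {u v} → u ≺ v → rank u < rank v
      rank-mono {u} {v} u≺v = ℕₚ.≰⇒> λ le →
        proj₁ (proj₂ (leastMissing v)) (descent-≤ (s≤s le) (u , u≺v , descent-rank u))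

  module Depth2 (P : TreePoset) (x : TreePoset.Carrier P) where
    open TreePoset P
    open Graph _~_

    D : Carrier → ℕ
    D = dist x

    walkTo : ∀ u → Walk (D u) x u
    walkTo u = proj₁ (proj₂ (distance _~?_ (proj₁ isTree) x u))

    D-min : ∀ {u k} → Walk k x u → D u ≤ k
    D-min {u} w = proj₂ (proj₂ (distance _~?_ (proj₁ isTree) x u)) _ w

    ~-sym : ∀ {u v} → u ~ v → v ~ u
    ~-sym = symmetric _⋖_

    walk₀ : ∀ {k u} → Walk k x u → k ≡ 0 → x ≡ u
    walk₀ [] refl = refl

    walk₁ : ∀ {k u} → Walk k x u → k ≡ 1 → x ~ u
    walk₁ (e ∷ []) refl = e

    D≡0⇒≡ : ∀ {u} → D u ≡ 0 → x ≡ u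
    D≡0⇒≡ {u} = walk₀ (walkTo u)

    D≡1⇒~ : ∀ {u} → D u ≡ 1 → x ~ u
    D≡1⇒~ {u} = walk₁ (walkTo u)

    Dx≡0 : D x ≡ 0
    Dx≡0 = ℕₚ.n≤0⇒n≡0 (D-min [])

    hasParent : ∀ {u} → D u ≡ 2 → ∃[ v ] D v ≡ 1 × v ~ u
    hasParent {u} Du with D u | walkTo u | D-min {u}
    hasParent {u} refl | _ | e ∷ (f ∷ []) | min = _ , D≡1 , f
      where
      D≡1 : D _ ≡ 1
      -- If the middle vertex were `x`, the second edge alone would be a walk shorter than the
      -- distance.
      D≡1 = ℕₚ.≤-antisym (D-min (e ∷ [])) (ℕₚ.n≢0⇒n>0 λ D≡0 →
        case D≡0⇒≡ D≡0 of λ { refl → contradiction (min (f ∷ [])) λ { (s≤s ()) } })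

    -- Two different parents would close the cycle u, v, x, w.
    parent-unique : ∀ {u v w} → D u ≡ 2 → D v ≡ 1 → D w ≡ 1 → v ~ u → w ~ u → v ≡ w
    parent-unique {u} {v} {w} Du Dv Dw v~u w~u with v ≟ᶠ w
    ... | yes v≡w = v≡w
    ... | no v≢w = contradiction cycle (proj₂ isTree u (v ∷ x ∷ w ∷ []))
      where
      differ : ∀ {a b i j} → D a ≡ i → D b ≡ j → i ≢ j → a ≢ b
      differ refl refl i≢j refl = i≢j refl
      cycle : IsCycle u (v ∷ x ∷ w ∷ [])
      cycle = s≤s (s≤s z≤n)
            , ((differ Du Dv (λ ()) ∷ differ Du Dx≡0 (λ ()) ∷ differ Du Dw (λ ()) ∷ [])
              ∷ (differ Dv Dx≡0 (λ ()) ∷ v≢w ∷ []) ∷ (differ Dx≡0 Dw (λ ()) ∷ []) ∷ [] ∷ [])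
            , (~-sym v~u ∷ ~-sym (D≡1⇒~ Dv) ∷ D≡1⇒~ Dw ∷ w~u ∷ [-])

    private
      isParent? : ∀ u v → Dec (D v ≡ 1 × v ~ u)
      isParent? u v = (D v ℕₚ.≟ 1) ×-dec (v ~? u)

    abstract
      parent : Carrier → Carrier
      parent u with anyᶠ? (isParent? u)
      ... | yes (v , _) = v
      -- A default value; at distance 2 from `x` a parent exists by `hasParent`.
      ... | no _        = x

      parent-spec : ∀ {u} → D u ≡ 2 → D (parent u) ≡ 1 × parent u ~ u
      parent-spec {u} Du with anyᶠ? (isParent? u)
      ... | yes (_ , spec) = spec
      ... | no none        = contradiction (hasParent Du) none

      parent-≡ : ∀ {u v} → D u ≡ 2 → D v ≡ 1 → v ~ u → v ≡ parent u
      parent-≡ Du Dv v~u = let Dp , p~u = parent-spec Du in parent-unique Du Dv Dp v~u p~u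

  -- The budget next to one parent: 1 + N sets placed before, at most 2 N sets shared with other
  -- parents, and N requests.
  close-room : ∀ N {a} → 1 ≤ N → a ≤ 1 + N + 2 * N → a + N ≤ 8 * N
  close-room N {a} 1≤N le = begin
    a + N                       ≤⟨ ℕₚ.+-monoˡ-≤ N le ⟩
    1 + N + 2 * N + N           ≤⟨ ℕₚ.+-monoˡ-≤ N (ℕₚ.+-monoˡ-≤ (2 * N) (ℕₚ.+-monoˡ-≤ N 1≤N)) ⟩
    N + N + 2 * N + N           ≤⟨ ℕₚ.m≤m+n _ (3 * N) ⟩
    N + N + 2 * N + N + 3 * N   ≡⟨ e N ⟩
    8 * N ∎
    where
    open ℕₚ.≤-Reasoning
    e : ∀ N → N + N + 2 * N + N + 3 * N ≡ 8 * N
    e = solve-∀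

  -- The budget of the common run: 1 + N sets placed before, at most N n neighbours of parents, and
  -- at most N n requests, since `d ≤ n`.
  far-room : ∀ N n → 1 ≤ N → 1 ≤ n → 1 + N + N * n + N * n ≤ 8 * N * n
  far-room N n 1≤N 1≤n = begin
    1 + N + N * n + N * n
      ≤⟨ ℕₚ.+-monoˡ-≤ (N * n) (ℕₚ.+-monoˡ-≤ (N * n) (+-mono-≤ (ℕₚ.*-mono-≤ 1≤N 1≤n)
           (ℕₚ.m≤m*n N n {{>-nonZero 1≤n}}))) ⟩
    N * n + N * n + N * n + N * n               ≤⟨ ℕₚ.m≤m+n _ (4 * (N * n)) ⟩
    N * n + N * n + N * n + N * n + 4 * (N * n) ≡⟨ e N n ⟩
    8 * N * n ∎
    where
    open ℕₚ.≤-Reasoning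
    e : ∀ N n → N * n + N * n + N * n + N * n + 4 * (N * n) ≡ 8 * N * n
    e = solve-∀

  length-concatMap-≤ : ∀ {X Y : Set} (g : X → List Y) xs k → (∀ y → length (g y) ≤ k) →
    length (concatMap g xs) ≤ length xs * k
  length-concatMap-≤ g xs k le =
        ≤-trans (≤-reflexive (trans (length-∑ (concatMap g xs)) (∑-concatMap g xs _)))
    (≤-trans (∑-mono xs (λ y → ≤-trans (≤-reflexive (sym (length-∑ (g y)))) (le y)))
          (≤-reflexive (∑-const xs k)))

  module Embedding
    (P : TreePoset) (x : TreePoset.Carrier P) (depth : ∀ u → TreePoset.dist P x u ≤ 2)
    (h : ℕ) (rank : TreePoset.Carrier P → ℕ) (rank≤ : ∀ u → rank u ≤ h)
    (rank-mono : ∀ {u v} → TreePoset._≺_ P u v → rank u < rank v)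
    {n : ℕ} (F : List (Subset n)) (k : ℕ) .{{_ : NonZero k}}
    (A : Subset n) (A-branches : Branches F h k 2 (rank x) A)
    (d : ℕ) .{{_ : NonZero d}} (room : k * (8 * (TreePoset.size P * d)) ≤ n)
    where

    open TreePoset P
    open Depth2 P x

    Index : Set
    Index = Carrier × ℕ

    _≟ᵢ_ : (p q : Index) → Dec (p ≡ q)
    _≟ᵢ_ = ≡-decˣ _≟ᶠ_ ℕₚ._≟_

    ~⇒rank≢ : ∀ {u v} → u ~ v → rank u ≢ rank v
    ~⇒rank≢ (fwd e) eq = ℕₚ.<⇒≢ (rank-mono (proj₁ e)) eq
    ~⇒rank≢ (bwd e) eq = ℕₚ.<⇒≢ (rank-mono (proj₁ e)) (sym eq)

    module _ {r i B} (b : Branches F h k (suc r) i B) where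

      abstract
        candidates : ∀ j → j ≤ h → List (Subset n)
        candidates j j≤h with i ℕₚ.≟ j
        -- Equal positions do not arise along an edge of the Hasse diagram, by `~⇒rank≢`.
        ... | yes _  = []
        ... | no i≢j = proj₁ (proj₂ b j j≤h i≢j)

        candidates-unique : ∀ j j≤h → Unique (candidates j j≤h)
        candidates-unique j j≤h with i ℕₚ.≟ j
        ... | yes _  = []
        ... | no i≢j = proj₁ (proj₂ (proj₂ b j j≤h i≢j))

        candidates-rich : ∀ j j≤h → i ≢ j → Rich k B (candidates j j≤h)
        candidates-rich j j≤h i≢j with i ℕₚ.≟ j
        ... | yes i≡j = contradiction i≡j i≢j
        ... | no i≢j′ = proj₁ (proj₂ (proj₂ (proj₂ b j j≤h i≢j′)))

        candidates-sound : ∀ j j≤h {C} → C ∈ candidates j j≤h →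
              B ≢ C × Comparable i j B C × Branches F h k r j C
        candidates-sound j j≤h C∈ with i ℕₚ.≟ j
        candidates-sound j j≤h () | yes _
        ... | no i≢j = proj₂ (proj₂ (proj₂ (proj₂ b j j≤h i≢j))) C∈

    private
      N : ℕ
      N = size * d

    abstract
      -- Requests are made for every element of P, whatever its distance from `x`, which keeps their
      -- number at `size * k`. Answers for an element at another distance never become images.
      slots : ℕ → List Index
      slots k = cartesianProduct (allFin size) (upTo k)

      length-slots : ∀ k → length (slots k) ≡ size * k
      length-slots k = trans (length-∑ (slots k)) (trans
            (∑-cartesianProductWith _,_ (allFin size) (upTo k) _)
        (trans (∑-cong (allFin size) (λ _ → trans (sym (length-∑ (upTo k))) (length-upTo k)))
          (trans (∑-const (allFin size) k) (cong (_* k) (length-tabulate {n = size} id)))))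

      ∈-slots : ∀ {k} u {i} → i < k → (u , i) ∈ slots k
      ∈-slots u i<k = ∈-cartesianProduct⁺ (∈-allFin u) (∈-upTo⁺ i<k)

    first : Index → List (Subset n)
    first (u , _) = candidates A-branches (rank u) (rank≤ u)

    first-branches : ∀ p {B} → B ∈ first p → Branches F h k 1 (rank (proj₁ p)) B
    first-branches (u , _) B∈ = proj₂ (proj₂ (candidates-sound A-branches (rank u) (rank≤ u) B∈))

    private
      module Stage₁ = Representatives (representatives _≟ₛ_ _≟ᵢ_ A (slots d) first
        (λ (u , _) → candidates-unique A-branches (rank u) (rank≤ u)) (A ∷ []))

    f₁ : Index → Subset n
    f₁ = Stage₁.pick

    private
      instance
        size≢0 : NonZero size
        size≢0 = nonEmpty x
          where
          nonEmpty : ∀ {k} → Fin k → NonZero k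
          nonEmpty {suc _} _ = _
        N≢0 : NonZero N
        N≢0 = ℕₚ.m*n≢0 size d

      1≤N : 1 ≤ N
      1≤N = >-nonZero⁻¹ N

      8N≤n : 8 * N ≤ n
      8N≤n = ≤-trans (ℕₚ.m≤n*m (8 * N) k) room

      1≤n : 1 ≤ n
      1≤n = ≤-trans (≤-trans 1≤N (ℕₚ.m≤n*m N 8)) 8N≤n

      d≤n : d ≤ n
      d≤n = ≤-trans (≤-trans (ℕₚ.m≤n*m d size) (ℕₚ.m≤n*m N 8)) 8N≤n

      adjacent-enough : ∀ {α} → n ≤ k * α → 8 * N ≤ α
      adjacent-enough le = ℕₚ.*-cancelˡ-≤ k (≤-trans room le)

      total-enough : ∀ {β} → n * n ≤ k * β → 8 * N * n ≤ β
      total-enough le = ℕₚ.*-cancelˡ-≤ k (≤-trans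
        (≤-reflexive (sym (ℕₚ.*-assoc k (8 * N) n))) (≤-trans (ℕₚ.*-monoˡ-≤ n room) le))

      8N≤8Nn : 8 * N ≤ 8 * N * n
      8N≤8Nn = ℕₚ.m≤m*n (8 * N) n {{>-nonZero 1≤n}}

      rich⇒8N≤ : ∀ B L → Rich k B L → 8 * N ≤ length L
      rich⇒8N≤ B L (inj₁ le) = ≤-trans (adjacent-enough le) (length-filter (_∈? neighbours B) L)
      rich⇒8N≤ B L (inj₂ le) = ≤-trans 8N≤8Nn (total-enough le)

      served₁ : ∀ {u} i → D u ≡ 1 → Stage₁.Served (u , i)
      served₁ {u} i Du = ≤-trans (≤-trans (≤-reflexive (cong suc (length-slots d)))
          (≤-trans (ℕₚ.m≤m+n (1 + N) (2 * N)) (≤-trans (ℕₚ.m≤m+n _ N) (close-room N 1≤N ≤-refl))))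
        (rich⇒8N≤ A (first (u , i)) (candidates-rich A-branches (rank u) (rank≤ u) (~⇒rank≢ (D≡1⇒~ Du))))

    f₁-∈ : ∀ {u i} → D u ≡ 1 → i < d → f₁ (u , i) ∈ first (u , i)
    f₁-∈ {u} {i} Du i<d = Stage₁.picked (∈-slots u i<d) (served₁ i Du)

    f₁-injective : ∀ {u v i j} → D u ≡ 1 → D v ≡ 1 → i < d → j < d → f₁ (u , i) ≡ f₁ (v , j) →
          (u , i) ≡ (v , j)
    f₁-injective {u} {v} {i} {j} Du Dv i<d j<d =
      Stage₁.injective (∈-slots u i<d) (∈-slots v j<d) (served₁ i Du) (served₁ j Dv)

    abstract
      -- The answer to an unserved request of the first stage may be junk about which no branching
      -- is known, hence the test.
      second : Index → Carrier → List (Subset n)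
      second p u with f₁ p ∈? first p
      ... | yes m = candidates (first-branches p m) (rank u) (rank≤ u)
      ... | no _  = []

      second-unique : ∀ p u → Unique (second p u)
      second-unique p u with f₁ p ∈? first p
      ... | yes m = candidates-unique (first-branches p m) (rank u) (rank≤ u)
      ... | no _  = []

      second-rich : ∀ p u → f₁ p ∈ first p → rank (proj₁ p) ≢ rank u → Rich k (f₁ p) (second p u)
      second-rich p u m′ ≢ with f₁ p ∈? first p
      ... | yes m = candidates-rich (first-branches p m) (rank u) (rank≤ u) ≢
      ... | no ¬m = contradiction m′ ¬m

      second-sound : ∀ p u {C} → C ∈ second p u → Comparable (rank (proj₁ p)) (rank u) (f₁ p) C × C ∈ F
      second-sound p u C∈ with f₁ p ∈? first p
      second-sound p u () | no _
      ... | yes m = proj₂ (candidates-sound (first-branches p m) (rank u) (rank≤ u) C∈)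

    placed : List (Subset n)
    placed = A ∷ map f₁ (slots d)

    -- Requests for hypercube neighbours of a parent avoid the sets adjacent to
    -- another parent, at most two for each; the remaining requests have quadratically
    -- many candidates and can avoid all neighbours of all parents.
    shared : Index → List (Subset n)
    shared p = concatMap (λ q → commonNeighbours (f₁ p) (f₁ q)) (slots d)

    surroundings : List (Subset n)
    surroundings = concatMap (neighbours ∘ f₁) (slots d)

    close : Index → Index → List (Subset n)
    close p (u , _) = adjacentTo (f₁ p) (second p u)

    private
      -- One independent run for each copy of a parent; `shared p` keeps the results of different
      -- runs apart. The run `Stage₂′` below is common to all parents.
      module Stage₂ p = Representatives (representatives _≟ₛ_ _≟ᵢ_ A (slots d) (close p)
        (λ (u , _) → Uniqueₚ.filter⁺ (_∈? neighbours (f₁ p)) (second-unique p u)) (placed ++ shared p))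

      module Stage₂′ = Representatives (representatives _≟ₛ_ _≟ᵢ_ A (slots (d * d))
            (λ (u , i) → second (parent u , i / d) u)
        (λ (u , i) → second-unique (parent u , i / d) u) (placed ++ surroundings))

    Near : Carrier → ℕ → Set
    Near u i = n ≤ k * length (adjacentTo (f₁ (parent u , i / d)) (second (parent u , i / d) u))

    near? : ∀ u i → Dec (Near u i)
    near? u i = n ℕₚ.≤? k * length (adjacentTo (f₁ (parent u , i / d)) (second (parent u , i / d) u))

    place : ∀ u i → Dec (Near u i) → Subset n
    place u i (yes _) = Stage₂.pick (parent u , i / d) (u , i % d)
    place u i (no _)  = Stage₂′.pick (u , i)

    ψ₂ : Carrier → ℕ → Subset n
    ψ₂ u i = place u i (near? u i)

    private
      length-placed : length placed ≡ 1 + N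
      length-placed = cong suc (trans (length-map f₁ (slots d)) (length-slots d))

      length-shared : ∀ p → length (shared p) ≤ 2 * N
      length-shared p = ≤-trans
        (length-concatMap-≤ (λ q → commonNeighbours (f₁ p) (f₁ q)) (slots d) 2
              (λ q → length-commonNeighbours (f₁ p) (f₁ q)))
        (≤-reflexive (trans (cong (_* 2) (length-slots d)) (ℕₚ.*-comm N 2)))

      length-surroundings : length surroundings ≤ N * n
      length-surroundings = ≤-trans
        (length-concatMap-≤ (neighbours ∘ f₁) (slots d) n (λ q → ≤-reflexive (length-neighbours (f₁ q))))
        (≤-reflexive (cong (_* n) (length-slots d)))

      length-slots-dd : length (slots (d * d)) ≤ N * n
      length-slots-dd = ≤-trans (≤-reflexive (trans (length-slots (d * d)) (sym (ℕₚ.*-assoc size d d))))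
            (ℕₚ.*-monoʳ-≤ N d≤n)

      served₂ : ∀ p {a} → 8 * N ≤ a → length (placed ++ shared p) + length (slots d) ≤ a
      served₂ p {a} le = begin
        length (placed ++ shared p) + length (slots d)
          ≡⟨ cong₂ _+_ (length-++ placed) (length-slots d) ⟩
        length placed + length (shared p) + N
          ≤⟨ close-room N 1≤N (+-mono-≤ (≤-reflexive length-placed) (length-shared p)) ⟩
        8 * N                                              ≤⟨ le ⟩
        a ∎
        where open ℕₚ.≤-Reasoning

      served₂′ : ∀ {a} → 8 * N * n ≤ a → length (placed ++ surroundings) + length (slots (d * d)) ≤ a
      served₂′ {a} le = begin
        length (placed ++ surroundings) + length (slots (d * d))
          ≡⟨ cong (_+ length (slots (d * d))) (length-++ placed) ⟩
        length placed + length surroundings + length (slots (d * d))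
          ≤⟨ +-mono-≤ (+-mono-≤ (≤-reflexive length-placed) length-surroundings) length-slots-dd ⟩
        1 + N + N * n + N * n                              ≤⟨ far-room N n 1≤N 1≤n ⟩
        8 * N * n                                          ≤⟨ le ⟩
        a ∎
        where open ℕₚ.≤-Reasoning

    module _ {u i} (Du : D u ≡ 2) (i<dd : i < d * d) where

      p : Index
      p = parent u , i / d

      i/d<d : i / d < d
      i/d<d = m<n*o⇒m/o<n i<dd

      p∈ : p ∈ slots d
      p∈ = ∈-slots (parent u) i/d<d

      f₁p∈ : f₁ p ∈ first p
      f₁p∈ = f₁-∈ (proj₁ (parent-spec Du)) i/d<d

      Close Far : Set
      Close = ψ₂ u i ≡ Stage₂.pick p (u , i % d) × (u , i % d) ∈ slots d × Stage₂.Served p (u , i % d)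
      Far   = ψ₂ u i ≡ Stage₂′.pick (u , i) × (u , i) ∈ slots (d * d) × Stage₂′.Served (u , i)

      close⊎far : Close ⊎ Far
      close⊎far = split (near? u i) refl
        where
        split : ∀ c → ψ₂ u i ≡ place u i c → Close ⊎ Far
        split (yes c) e = inj₁ (e , ∈-slots u (m%n<n i d) , served₂ p (adjacent-enough c))
        split (no ¬c) e = inj₂ (e , ∈-slots u i<dd , served₂′
              (total-enough (fromInj₂ (λ c → contradiction c ¬c)
          (second-rich p u f₁p∈ (~⇒rank≢ (proj₂ (parent-spec Du)))))))

      close⇒neighbour : Close → ψ₂ u i ∈ second p u × ψ₂ u i ∈ neighbours (f₁ p)
      close⇒neighbour (e , s∈ , served) = subst (λ C → C ∈ second p u × C ∈ neighbours (f₁ p)) (sym e)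
        (∈-filter⁻ (_∈? neighbours (f₁ p)) {xs = second p u} (Stage₂.picked p s∈ served))

      close⇒unused : Close → ψ₂ u i ∉ placed ++ shared p
      close⇒unused (e , s∈ , served) = subst (_∉ placed ++ shared p) (sym e) (Stage₂.unused p s∈ served)

      far⇒unused : Far → ψ₂ u i ∉ placed ++ surroundings
      far⇒unused (e , s∈ , served) = subst (_∉ placed ++ surroundings) (sym e) (Stage₂′.unused s∈ served)

      ψ₂-∈ : ψ₂ u i ∈ second p u
      ψ₂-∈ = [ proj₁ ∘ close⇒neighbour
             , (λ (e , s∈ , served) → subst (_∈ second p u) (sym e) (Stage₂′.picked s∈ served)) ]′ close⊎far

      ψ₂-∉ : ψ₂ u i ∉ placed
      ψ₂-∉ = [ (λ c → close⇒unused c ∘ ∈-++⁺ˡ) , (λ f → far⇒unused f ∘ ∈-++⁺ˡ) ]′ close⊎far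

    module _ {u v i j} (Du : D u ≡ 2) (Dv : D v ≡ 2) (i< : i < d * d) (j< : j < d * d) where

      private
        p₁ = p Du i<
        p₂ = p Dv j<

      close≢far : Close Du i< → Far Dv j< → ψ₂ u i ≢ ψ₂ v j
      close≢far c f eq = far⇒unused Dv j< f (∈-++⁺ʳ placed (∈-concatMap⁺ (neighbours ∘ f₁) (lose (p∈ Du i<)
        (subst (_∈ neighbours (f₁ p₁)) eq (proj₂ (close⇒neighbour Du i< c))))))

      -- Under one parent copy, both images come from the same run, and `i` is recovered from its
      -- quotient and remainder by `d`. Under two copies, the parents have distinct images, and a
      -- common value would be a common neighbour of these, which `shared` excludes.
      close-injective : Close Du i< → Close Dv j< → ψ₂ u i ≡ ψ₂ v j → (u , i) ≡ (v , j)
      close-injective c@(e , s∈ , served) c′@(e′ , s∈′ , served′) eq = split (p₁ ≟ᵢ p₂)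
        where
        same : p₁ ≡ p₂ → (u , i % d) ≡ (v , j % d)
        same p≡ = Stage₂.injective p₁ s∈ s∈′ served (subst (λ q → Stage₂.Served q (v , j % d))
              (sym p≡) served′)
          (trans (sym e) (trans eq (trans e′ (cong (λ q → Stage₂.pick q (v , j % d)) (sym p≡)))))
        f₁p≢ : p₁ ≢ p₂ → f₁ p₁ ≢ f₁ p₂
        f₁p≢ p≢ = p≢ ∘ f₁-injective (proj₁ (parent-spec Du)) (proj₁ (parent-spec Dv)) (i/d<d Du i<)
              (i/d<d Dv j<)
        split : Dec (p₁ ≡ p₂) → (u , i) ≡ (v , j)
        split (yes p≡) = cong₂ _,_ (cong proj₁ (same p≡)) (trans (m≡m%n+[m/n]*n i d) (trans
          (cong₂ (λ a b → a + b * d) (cong proj₂ (same p≡)) (cong proj₂ p≡)) (sym (m≡m%n+[m/n]*n j d))))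
        split (no p≢) = contradiction
          (∈-++⁺ʳ placed (∈-concatMap⁺ (λ q → commonNeighbours (f₁ p₁) (f₁ q)) (lose (p∈ Dv j<)
            (∈-commonNeighbours (f₁p≢ p≢) (proj₂ (close⇒neighbour Du i< c))
              (subst (_∈ neighbours (f₁ p₂)) (sym eq) (proj₂ (close⇒neighbour Dv j< c′)))))))
          (close⇒unused Du i< c)

      far-injective : Far Du i< → Far Dv j< → ψ₂ u i ≡ ψ₂ v j → (u , i) ≡ (v , j)
      far-injective (e , s∈ , served) (e′ , s∈′ , served′) eq =
        Stage₂′.injective s∈ s∈′ served served′ (trans (sym e) (trans eq e′))

    ψ₂-injective : ∀ {u v i j} → D u ≡ 2 → D v ≡ 2 → i < d * d → j < d * d → ψ₂ u i ≡ ψ₂ v j →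
          (u , i) ≡ (v , j)
    ψ₂-injective Du Dv i< j< eq =
      [ (λ c → [ (λ c′ → close-injective Du Dv i< j< c c′ eq) ,
            (λ f → contradiction eq (close≢far Du Dv i< j< c f)) ]′ (close⊎far Dv j<))
      , (λ f → [ (λ c → contradiction (sym eq) (close≢far Dv Du j< i< c f)) ,
            (λ f′ → far-injective Du Dv i< j< f f′ eq) ]′ (close⊎far Dv j<))
      ]′ (close⊎far Du i<)

    -- ψ u k i is the image of uⁱ when u is at distance k from x.
    ψ : Carrier → ℕ → ℕ → Subset n
    ψ u 0             i = A
    ψ u 1             i = f₁ (u , i)
    ψ u (suc (suc _)) i = ψ₂ u i

    private
      2≡ : ∀ {u k} → D u ≡ suc (suc k) → k ≡ 0
      2≡ {u} Du = ℕₚ.n≤0⇒n≡0 (ℕₚ.≤-pred (ℕₚ.≤-pred (subst (_≤ 2) Du (depth u))))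

      <d : ∀ {i} → i < d ^ 1 → i < d
      <d {i} = subst (i <_) (ℕₚ.^-identityʳ d)

      <dd : ∀ {i} → i < d ^ 2 → i < d * d
      <dd {i} = subst (λ m → i < d * m) (ℕₚ.^-identityʳ d)

    ψ∈F : ∀ u k {i} → D u ≡ k → i < d ^ k → ψ u k i ∈ F
    ψ∈F u 0 Du i< = Branches⇒∈ F h k 2 A-branches
    ψ∈F u 1 Du i< = Branches⇒∈ F h k 1 (proj₂ (proj₂ (candidates-sound A-branches (rank u) (rank≤ u)
          (f₁-∈ Du (<d i<)))))
    ψ∈F u (suc (suc k)) {i} Du i< with 2≡ Du
    ... | refl = proj₂ (second-sound (p Du (<dd i<)) u (ψ₂-∈ Du (<dd i<)))

    ψ₁∈placed : ∀ {u i} → i < d → f₁ (u , i) ∈ placed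
    ψ₁∈placed {u} i<d = there (∈-map⁺ f₁ (∈-slots u i<d))

    f₁≢A : ∀ {u i} → D u ≡ 1 → i < d → f₁ (u , i) ≢ A
    f₁≢A {u} Du i<d eq = proj₁ (candidates-sound A-branches (rank u) (rank≤ u) (f₁-∈ Du i<d)) (sym eq)

    ψ-injective : ∀ u v k l {i j} → D u ≡ k → D v ≡ l → i < d ^ k → j < d ^ l → ψ u k i ≡ ψ v l j →
          (u , i) ≡ (v , j)
    ψ-injective u v 0 0 Du Dv i< j< eq =
      cong₂ _,_ (trans (sym (D≡0⇒≡ Du)) (D≡0⇒≡ Dv)) (trans (ℕₚ.n<1⇒n≡0 i<) (sym (ℕₚ.n<1⇒n≡0 j<)))
    ψ-injective u v 0 1 Du Dv i< j< eq = contradiction (sym eq) (f₁≢A Dv (<d j<))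
    ψ-injective u v 1 0 Du Dv i< j< eq = contradiction eq (f₁≢A Du (<d i<))
    ψ-injective u v 1 1 Du Dv i< j< eq = f₁-injective Du Dv (<d i<) (<d j<) eq
    ψ-injective u v 0 (suc (suc l)) Du Dv i< j< eq with 2≡ Dv
    ... | refl = contradiction (here (sym eq)) (ψ₂-∉ Dv (<dd j<))
    ψ-injective u v 1 (suc (suc l)) Du Dv i< j< eq with 2≡ Dv
    ... | refl = contradiction (subst (_∈ placed) eq (ψ₁∈placed (<d i<))) (ψ₂-∉ Dv (<dd j<))
    ψ-injective u v (suc (suc k)) 0 Du Dv i< j< eq with 2≡ Du
    ... | refl = contradiction (here eq) (ψ₂-∉ Du (<dd i<))
    ψ-injective u v (suc (suc k)) 1 Du Dv i< j< eq with 2≡ Du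
    ... | refl = contradiction (subst (_∈ placed) (sym eq) (ψ₁∈placed (<d j<))) (ψ₂-∉ Du (<dd i<))
    ψ-injective u v (suc (suc k)) (suc (suc l)) Du Dv i< j< eq with 2≡ Du | 2≡ Dv
    ... | refl | refl = ψ₂-injective Du Dv (<dd i<) (<dd j<) eq

    ψ-comparable : ∀ u v k {i j} → D v ≡ k → D u ≡ suc k → v ~ u → i < d ^ suc k → j < d ^ k →
      (∃[ r ] i ≡ j * d + toℕ {d} r) → Comparable (rank v) (rank u) (ψ v k j) (ψ u (suc k) i)
    ψ-comparable u v 0 Dv Du v~u i< j< _ with D≡0⇒≡ Dv
    ... | refl = proj₁ (proj₂ (candidates-sound A-branches (rank u) (rank≤ u) (f₁-∈ Du (<d i<))))
    ψ-comparable u v 1 {i} {j} Dv Du v~u i< j< (r , e) =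
      subst (λ q → Comparable (rank (proj₁ q)) (rank u) (f₁ q) (ψ₂ u i)) (sym v,j)
        (proj₁ (second-sound (p Du (<dd i<)) u (ψ₂-∈ Du (<dd i<))))
      where
      -- The blocks are intervals of length `d`, so the block of uⁱ is named by the quotient of `i`
      -- by `d`, the very index used by `ψ₂`.
      i/d≡j : i / d ≡ j
      i/d≡j = trans (cong (_/ d) (trans e (ℕₚ.+-comm (j * d) (toℕ r))))
        (trans (+-distrib-/-∣ʳ (toℕ r) (divides j refl))
          (cong₂ _+_ (m<n⇒m/n≡0 (toℕ<n r)) (m*n/n≡m j d)))
      v,j : (v , j) ≡ (parent u , i / d)
      v,j = cong₂ _,_ (parent-≡ Du Dv v~u) (sym i/d≡j)
    ψ-comparable u v (suc (suc k)) Dv Du v~u i< j< _ with 2≡ Du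
    ... | ()

    φ : Copies P x d → Subset n
    φ (u , i) = ψ u (D u) (toℕ i)

    φ∈F : ∀ a → φ a ∈ F
    φ∈F (u , i) = ψ∈F u (D u) refl (toℕ<n i)

    φ-injective : ∀ {a b} → φ a ≡ φ b → a ≡ b
    φ-injective {u , i} {v , j} eq = lift (ψ-injective u v (D u) (D v) refl refl (toℕ<n i) (toℕ<n j) eq)
      where
      lift : ∀ {u v} {i : Fin (d ^ D u)} {j : Fin (d ^ D v)} → (u , toℕ i) ≡ (v , toℕ j) →
        _≡_ {A = Copies P x d} (u , i) (v , j)
      lift {u} eq with cong proj₁ eq
      ... | refl = cong (u ,_) (toℕ-injective (cong proj₂ eq))

    φ-comparable : ∀ {a b} → InBlock P x d a b → proj₁ b ~ proj₁ a →
      Comparable (rank (proj₁ b)) (rank (proj₁ a)) (φ b) (φ a)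
    φ-comparable {u , i} {v , j} (Du , block) v~u =
      subst (λ l → Comparable (rank v) (rank u) (φ (v , j)) (ψ u l (toℕ i))) (sym Du)
        (ψ-comparable u v (D v) refl Du v~u (subst (λ k → toℕ i < d ^ k) Du (toℕ<n i)) (toℕ<n j) block)

    φ-edge : ∀ {a b} → _⟶_ P x d a b → φ a ⊆ φ b
    φ-edge (a⋖b , inj₁ block) = proj₂ (φ-comparable block (bwd a⋖b)) (rank-mono (proj₁ a⋖b))
    φ-edge (a⋖b , inj₂ block) = proj₁ (φ-comparable block (fwd a⋖b)) (rank-mono (proj₁ a⋖b))

    φ-mono : ∀ {a b} → _⟶*_ P x d a b → φ a ⊆ φ b
    φ-mono ε       = id
    φ-mono (e ◅ p) = φ-mono p ∘ φ-edge e

open import Data.Nat.Base using (ℕ; zero; suc; _≤_; z≤n; s≤s; ⌊_/2⌋; NonZero; >-nonZero)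
import Data.Nat.Base as ℕ
open import Data.Nat.Combinatorics using (_C_)
open import Data.Nat.Coprimality using (Coprime)
import Data.Nat.Properties as ℕₚ
import Data.Nat.DivMod as ℕᵈ
import Data.Nat.Tactic.RingSolver as ℕSolver
import Data.Integer.Base as ℤ
import Data.Integer.Properties as ℤₚ
import Data.Integer.Tactic.RingSolver as ℤSolver
open import Data.Rational.Base
  using (ℚ; 0ℚ; 1ℚ; mkℚ; floor; toℚᵘ; _+_; _-_; -_; _*_; *<*)
  renaming (_<_ to _<ℚ_; _≤_ to _≤ℚ_; _/_ to _÷_)
import Data.Rational.Properties as ℚₚ
open import Data.Rational.Unnormalised.Base as ℚᵘ using (mkℚᵘ; *≡*; *≤*)
import Data.Rational.Unnormalised.Properties as ℚᵘₚ
open import Data.List.Base using (List; []; _∷_; length)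
open import Data.List.Relation.Unary.Unique.Propositional using (Unique)
open import Data.Fin.Subset using (Subset)
open import Data.List.Membership.Propositional using (_∈_)
open import Data.List.Relation.Unary.All using ([])
open import Data.List.Relation.Unary.AllPairs using ([]; _∷_)
open import Data.Product using (_×_; ∃-syntax; _,_; proj₁; proj₂)
open import Relation.Nullary using (contradiction)
open import Relation.Binary.PropositionalEquality using (_≡_; refl; sym; trans; cong; subst; subst₂)
open Combinatorics

-- From rational to natural parameters

toℚᵘ-fromℕ : ∀ m → toℚᵘ (fromℕ m) ℚᵘ.≃ mkℚᵘ (ℤ.+ m) 0
toℚᵘ-fromℕ m = ℚₚ.toℚᵘ-fromℚᵘ (mkℚᵘ (ℤ.+ m) 0)

-- The product of δ and n is stored in lowest terms, so it is compared with n / (k + 1) by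
-- cross-multiplication; natural division does not see the common factor.
floor-≃ : ∀ r n k → toℚᵘ r ℚᵘ.≃ mkℚᵘ (ℤ.+ n) k → ℤ.∣ floor r ∣ ≡ n ℕ./ suc k
floor-≃ (mkℚ (ℤ.+ a) d _) n k (*≡* eq) = trans
  (cong ℤ.∣_∣ (ℤₚ.*-identityˡ (ℤ.+ (a ℕ./ suc d))))
  (trans (sym (ℕᵈ.m*n/o*n≡m/o a (suc k) (suc d)))
  (trans (ℕᵈ./-congˡ {o = suc d ℕ.* suc k} cross)
  (trans (ℕᵈ./-congʳ {m = n ℕ.* suc d} (ℕₚ.*-comm (suc d) (suc k)))
         (ℕᵈ.m*n/o*n≡m/o n (suc d) (suc k)))))
  where
  cross : a ℕ.* suc k ≡ n ℕ.* suc d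
  cross = ℤₚ.+-injective (trans (ℤₚ.pos-* a (suc k)) (trans eq (sym (ℤₚ.pos-* n (suc d)))))
floor-≃ (mkℚ ℤ.-[1+ a ] d _) n k (*≡* eq) with trans eq (sym (ℤₚ.pos-* n (suc d)))
... | ()

floor-reciprocal : ∀ k n → ⌊ ℤ.+ 1 ÷ suc k · n ⌋ ≡ n ℕ./ suc k
floor-reciprocal k n = floor-≃ ((ℤ.+ 1 ÷ suc k) * fromℕ n) n k
  (ℚᵘₚ.≃-trans (ℚₚ.toℚᵘ-homo-* (ℤ.+ 1 ÷ suc k) (fromℕ n))
  (ℚᵘₚ.≃-trans (ℚᵘₚ.*-cong (ℚₚ.toℚᵘ-fromℚᵘ (mkℚᵘ (ℤ.+ 1) k)) (toℚᵘ-fromℕ n))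
    (*≡* (e (ℤ.+ n) (ℤ.+ suc k)))))
  where
  e : ∀ n k → (ℤ.+ 1 ℤ.* n) ℤ.* k ≡ n ℤ.* (k ℤ.* ℤ.+ 1)
  e = ℤSolver.solve-∀

-- With numerator at least 1, ε is at least 1/q, and only this is kept; then everything is
-- multiplied by q.
density-ℕ : ∀ h p q-1 .(cop : Coprime (suc p) (suc q-1)) c f →
  (fromℕ (suc h) - 1ℚ + mkℚ (ℤ.+[1+ p ]) q-1 cop) * fromℕ c ≤ℚ fromℕ f →
  (suc q-1 ℕ.* h ℕ.+ 1) ℕ.* c ≤ suc q-1 ℕ.* f
density-ℕ h p q-1 cop c f le = ℕₚ.≤-trans
  (ℕₚ.*-monoˡ-≤ c (ℕₚ.+-monoʳ-≤ (q ℕ.* h) (s≤s z≤n)))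
  (ℤₚ.drop‿+≤+ (subst₂ ℤ._≤_ left right (ℚᵘₚ.drop-*≤* le′)))
  where
  q = suc q-1
  ε = mkℚ (ℤ.+[1+ p ]) q-1 cop
  εᵘ = mkℚᵘ (ℤ.+[1+ p ]) q-1
  e₁ : ∀ h → ((ℤ.+ 1 ℤ.+ h) ℤ.* ℤ.+ 1 ℤ.+ ℤ.-[1+ 0 ] ℤ.* ℤ.+ 1) ℤ.* ℤ.+ 1 ≡ h ℤ.* ℤ.+ 1
  e₁ = ℤSolver.solve-∀
  predecessor : toℚᵘ (fromℕ (suc h) - 1ℚ) ℚᵘ.≃ mkℚᵘ (ℤ.+ h) 0
  predecessor = ℚᵘₚ.≃-trans (ℚₚ.toℚᵘ-homo-+ (fromℕ (suc h)) (- 1ℚ))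
    (ℚᵘₚ.≃-trans (ℚᵘₚ.+-cong (toℚᵘ-fromℕ (suc h)) (ℚᵘₚ.≃-refl {mkℚᵘ ℤ.-[1+ 0 ] 0})) (*≡* (e₁ (ℤ.+ h))))
  lhs : toℚᵘ ((fromℕ (suc h) - 1ℚ + ε) * fromℕ c) ℚᵘ.≃ (mkℚᵘ (ℤ.+ h) 0 ℚᵘ.+ εᵘ) ℚᵘ.* mkℚᵘ (ℤ.+ c) 0
  lhs = ℚᵘₚ.≃-trans (ℚₚ.toℚᵘ-homo-* (fromℕ (suc h) - 1ℚ + ε) (fromℕ c))
    (ℚᵘₚ.*-cong (ℚᵘₚ.≃-trans (ℚₚ.toℚᵘ-homo-+ (fromℕ (suc h) - 1ℚ) ε)
          (ℚᵘₚ.+-cong predecessor (ℚᵘₚ.≃-refl {εᵘ})))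
                (toℚᵘ-fromℕ c))
  le′ : (mkℚᵘ (ℤ.+ h) 0 ℚᵘ.+ εᵘ) ℚᵘ.* mkℚᵘ (ℤ.+ c) 0 ℚᵘ.≤ mkℚᵘ (ℤ.+ f) 0
  le′ = ℚᵘₚ.≤-respˡ-≃ lhs (ℚᵘₚ.≤-respʳ-≃ (toℚᵘ-fromℕ f) (ℚₚ.toℚᵘ-mono-≤ le))
  e₂ : ∀ h q s c → (h ℤ.* q ℤ.+ s ℤ.* ℤ.+ 1) ℤ.* c ℤ.* ℤ.+ 1 ≡ (q ℤ.* h ℤ.+ s) ℤ.* c
  e₂ = ℤSolver.solve-∀
  left : (ℤ.+ h ℤ.* ℤ.+ q ℤ.+ ℤ.+[1+ p ] ℤ.* ℤ.+ 1) ℤ.* ℤ.+ c ℤ.* ℤ.+ 1 ≡ ℤ.+ ((q ℕ.* h ℕ.+ suc p) ℕ.* c)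
  left = trans (e₂ (ℤ.+ h) (ℤ.+ q) (ℤ.+[1+ p ]) (ℤ.+ c)) (trans
    (cong (λ z → (z ℤ.+ ℤ.+ suc p) ℤ.* ℤ.+ c) (sym (ℤₚ.pos-* q h))) (sym (ℤₚ.pos-* (q ℕ.* h ℕ.+ suc p) c)))
  right : ℤ.+ f ℤ.* ℚᵘ.↧ ((mkℚᵘ (ℤ.+ h) 0 ℚᵘ.+ εᵘ) ℚᵘ.* mkℚᵘ (ℤ.+ c) 0) ≡ ℤ.+ (q ℕ.* f)
  right = trans (sym (ℤₚ.pos-* f _)) (cong ℤ.+_ (trans (ℕₚ.*-comm f _)
    (cong (ℕ._* f) (trans (ℕₚ.*-identityʳ (1 ℕ.* q)) (ℕₚ.*-identityˡ q)))))

-- From branching sets to the theorem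

module _ (P : TreePoset) (x : TreePoset.Carrier P) (depth : ∀ u → TreePoset.dist P x u ≤ 2)
         {h : ℕ} (height : TreePoset.IsHeight P (suc h)) where
  open TreePoset P using (size)
  open Rank (TreePoset.finPoset P)

  branches⇒copy : ∀ {n} (F : Family n) F′ → (∀ {A} → A ∈ F′ → A ∈ Family.members F) →
    ∀ k .{{_ : NonZero k}} A → Branches F′ h k 2 (rank (proj₂ height) x) A →
    ∀ d .{{_ : NonZero d}} → k ℕ.* (8 ℕ.* (size ℕ.* d)) ≤ n →
    ContainsCopy (familyPoset F) (blowUp P x d)
  branches⇒copy F F′ F′⊆F k A A-branches d room = record
    { ⟦_⟧ = λ a → φ a , F′⊆F (φ∈F a)
    ; isOrderHomomorphism = record { cong = λ { refl → refl } ; mono = φ-mono }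
    } , φ-injective
    where open Embedding P x depth h (rank (proj₂ height)) (rank≤ (proj₂ height)) (rank-mono (proj₂ height))
                         F′ k A A-branches d room

  DenseBranches DenseCopy : ℕ → ℕ → ℕ → Set
  DenseBranches q k N = ∀ {n} (F : List (Subset n)) → Unique F → N ≤ n →
    (q ℕ.* h ℕ.+ 1) ℕ.* (n C ⌊ n /2⌋) ≤ q ℕ.* length F →
    ∃[ F′ ] (∀ {A} → A ∈ F′ → A ∈ F) × (∀ i → i ≤ h → ∃[ A ] Branches F′ h k 2 i A)
  DenseCopy q k N = ∀ n → N ≤ n → (F : Family n) →
    (q ℕ.* h ℕ.+ 1) ℕ.* (n C ⌊ n /2⌋) ≤ q ℕ.* Family.card F →
    ContainsCopy (familyPoset F) (blowUp P x (n ℕ./ suc k))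

  -- The choice δ = 1/(κ + 1) with κ = 8 k `size` gives κ d ≤ n for d = n / (κ + 1), which is the
  -- room required by the embedding. The summand `suc κ` of the threshold ensures d ≥ 1.
  branches⇒dense : ∀ q k .{{_ : NonZero k}} N → DenseBranches q k N →
    DenseCopy q (k ℕ.* (8 ℕ.* size)) (N ℕ.+ suc (k ℕ.* (8 ℕ.* size)))
  branches⇒dense q k N spread n large F dense =
    let F′ , F′⊆F , spread′ = spread (Family.members F) (Family.unique F)
          (ℕₚ.≤-trans (ℕₚ.m≤m+n N (suc κ)) large) dense
        A , A-branches = spread′ (rank (proj₂ height) x) (rank≤ (proj₂ height) x)
    in branches⇒copy F F′ F′⊆F k A A-branches (n ℕ./ suc κ) room
    where
    κ : ℕ
    κ = k ℕ.* (8 ℕ.* size)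
    instance
      d≢0 : NonZero (n ℕ./ suc κ)
      d≢0 = >-nonZero (ℕᵈ.m≥n⇒m/n>0 (ℕₚ.≤-trans (ℕₚ.m≤n+m (suc κ) N) large))
    regroup : ∀ k s d → k ℕ.* (8 ℕ.* (s ℕ.* d)) ≡ d ℕ.* (k ℕ.* (8 ℕ.* s))
    regroup = ℕSolver.solve-∀
    room : k ℕ.* (8 ℕ.* (size ℕ.* (n ℕ./ suc κ))) ≤ n
    room = ℕₚ.≤-trans (ℕₚ.≤-reflexive (regroup k size (n ℕ./ suc κ)))
      (ℕₚ.≤-trans (ℕₚ.*-monoʳ-≤ (n ℕ./ suc κ) (ℕₚ.n≤1+n κ)) (ℕᵈ.m/n*n≤m n (suc κ)))

  dense⇒copy : ∀ q → 1 ≤ q → ∃[ k ] ∃[ N ] DenseCopy q k N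
  dense⇒copy q 1≤q =
    let k , k≢0 , N , spread = dense⇒branches q h 2 1≤q
    in k ℕ.* (8 ℕ.* size) , N ℕ.+ suc (k ℕ.* (8 ℕ.* size)) , branches⇒dense q k {{k≢0}} N spread

theorem1p7 : (P : TreePoset) (h : ℕ) (x : TreePoset.Carrier P) →
    TreePoset.IsHeight P h →
    (∀ u → TreePoset.dist P x u ≤ 2) →
    (ε : ℚ) → 0ℚ <ℚ ε →
    ∃[ δ ] 0ℚ <ℚ δ × (∃[ N ] (∀ n → N ≤ n → (F : Family n) →
    (fromℕ h - 1ℚ + ε) * fromℕ (n C ⌊ n /2⌋) ≤ℚ fromℕ (Family.card F) →
    ContainsCopy (familyPoset F) (blowUp P x ⌊ δ · n ⌋)))
-- The element `x` alone is a chain, so the height is positive.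
theorem1p7 P zero x height depth ε 0<ε = contradiction (proj₂ height (x ∷ []) ([] ∷ [])) λ ()
theorem1p7 P (suc h) x height depth (mkℚ (ℤ.+ zero) q _) (*<* (ℤ.+<+ ()))
theorem1p7 P (suc h) x height depth (mkℚ (ℤ.+[1+ p ]) q cop) 0<ε =
  let k , N , copy = dense⇒copy P x depth height (suc q) (s≤s z≤n)
  in ℤ.+ 1 ÷ suc k
   , ℚₚ.positive⁻¹ (ℤ.+ 1 ÷ suc k) {{ℚₚ.normalize-pos 1 (suc k)}}
   , N , λ n large F dense → subst (λ d → ContainsCopy (familyPoset F) (blowUp P x d))
       (sym (floor-reciprocal k n)) (copy n large F (density-ℕ h p q cop (n C ⌊ n /2⌋)
             (Family.card F) dense))
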